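{- (a) Suppose that $G$ is a noncyclotomic bipartite graph having a vertex $v$ such that the induced subgraph on $V(G)\setminus\{v\}$ is cyclotomic. Then $G$ is a Salem graph. (b) Suppose that $G$ is a noncyclotomic bipartite graph with the property that for each minimal induced subgraph $M$ of $G$, the complementary induced subgraph $G|_{V(G)\setminus V(M)}$ is cyclotomic. Then $G$ is a Salem graph.
   Context: Graphs are finite simple graphs; eigenvalues are those of the adjacency matrix; the index of a graph is its largest eigenvalue. A graph is cyclotomic if all its eigenvalues lie in $[-2,2]$. A minimal induced subgraph of $G$ means an induced subgraph of $G$ with index greater than $2$ such that every induced subgraph of it obtained by deleting one vertex has index at most $2$. A bipartite graph $G$ is a Salem graph if it has exactly one eigenvalue $\lambda>2$ and only the eigenvalue $-\lambda$ in $(-\infty,-2)$. -}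

module Defs where

open import Algebra.Bundles using (CommutativeRing)
open import Algebra.Definitions.RawMonoid using (sum)
open import Data.Bool.Base using (Bool; true; false; if_then_else_)
open import Data.Fin.Base using (Fin; zero; suc)
open import Data.Fin.Subset using (Subset; inside; outside; ∣_∣; ∁; ⁅_⁆)
open import Data.Nat.Base using (ℕ)
open import Data.Product.Base using (_×_; ∃; ∃-syntax)
open import Data.Vec.Base using ([]; _∷_)
open import Data.Vec.Functional using (Vector)
open import Level using (0ℓ) renaming (suc to lsuc)
open import Relation.Binary.Core using (Rel)
open import Relation.Binary.PropositionalEquality.Core using (_≡_; _≢_)
open import Relation.Binary.Structures using (IsTotalOrder)
open import Relation.Nullary.Negation.Core using (¬_)
import Relation.Binary.Construct.NonStrictToStrict as Strict

-- The real numbers, described classically (up to unique isomorphism) as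
-- a Dedekind-complete ordered field.  Equality is a setoid equality, so
-- that, for instance, Cauchy sequences of rationals are admitted as reals.
-- Totality of the order and existence of suprema presuppose classical logic.

record CompleteOrderedField : Set (lsuc 0ℓ) where
  infix 4 _≤_ _<_

  field
    commutativeRing : CommutativeRing 0ℓ 0ℓ

  open CommutativeRing commutativeRing public

  field
    _≤_          : Rel Carrier 0ℓ
    isTotalOrder : IsTotalOrder _≈_ _≤_
    0≉1          : ¬ (0# ≈ 1#)
    inverse      : ∀ x → ¬ (x ≈ 0#) → ∃[ y ] x * y ≈ 1#
    +-monoˡ-≤    : ∀ z {x y} → x ≤ y → x + z ≤ y + z
    *-nonNeg     : ∀ {x y} → 0# ≤ x → 0# ≤ y → 0# ≤ x * y

  _<_ : Rel Carrier 0ℓ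
  _<_ = Strict._<_ _≈_ _≤_

  UpperBound : (Carrier → Set) → Carrier → Set
  UpperBound P b = ∀ x → P x → x ≤ b

  field
    supremum : (P : Carrier → Set) → ∃ P → ∃ (UpperBound P) →
               ∃[ s ] UpperBound P s × (∀ b → UpperBound P b → s ≤ b)

  2# : Carrier
  2# = 1# + 1#

record Graph (n : ℕ) : Set where
  field
    adjacent  : Fin n → Fin n → Bool
    symmetric : ∀ i j → adjacent i j ≡ adjacent j i
    loopless  : ∀ i → adjacent i i ≡ false

open Graph public

Bipartite : ∀ {n} → Graph n → Set
Bipartite {n} G =
  ∃ λ (colour : Fin n → Bool) →
    ∀ i j → adjacent G i j ≡ true → colour i ≢ colour j

-- The increasing enumeration of the elements of a subset.

element : ∀ {n} (S : Subset n) → Fin ∣ S ∣ → Fin n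
element (inside  ∷ S) zero    = zero
element (inside  ∷ S) (suc i) = suc (element S i)
element (outside ∷ S) i       = suc (element S i)

infix 8 _[_]

_[_] : ∀ {n} → Graph n → (S : Subset n) → Graph ∣ S ∣
G [ S ] = record
  { adjacent  = λ i j → adjacent G (element S i) (element S j)
  ; symmetric = λ i j → symmetric G (element S i) (element S j)
  ; loopless  = λ i → loopless G (element S i)
  }

deleteVertex : ∀ {n} (G : Graph n) (v : Fin n) → Graph ∣ ∁ ⁅ v ⁆ ∣
deleteVertex G v = G [ ∁ ⁅ v ⁆ ]

module Spectrum (ℝ : CompleteOrderedField) where

  open CompleteOrderedField ℝ

  adjacencyMatrix : ∀ {n} → Graph n → Fin n → Fin n → Carrier
  adjacencyMatrix G i j = if adjacent G i j then 1# else 0#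

  _*ᵥ_ : ∀ {n} → (Fin n → Fin n → Carrier) → Vector Carrier n → Vector Carrier n
  (A *ᵥ x) i = sum +-rawMonoid (λ j → A i j * x j)

  InEigenspace : ∀ {n} → Graph n → Carrier → Vector Carrier n → Set
  InEigenspace G μ x = ∀ i → (adjacencyMatrix G *ᵥ x) i ≈ μ * x i

  Nonzero : ∀ {n} → Vector Carrier n → Set
  Nonzero x = ¬ (∀ i → x i ≈ 0#)

  Eigenvalue : ∀ {n} → Graph n → Carrier → Set
  Eigenvalue G μ = ∃[ x ] Nonzero x × InEigenspace G μ x

  -- Multiplicity one: the eigenspace is spanned by a single nonzero vector.
  -- The adjacency matrix is real symmetric, so geometric and algebraic
  -- multiplicities agree.

  SimpleEigenvalue : ∀ {n} → Graph n → Carrier → Set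
  SimpleEigenvalue G μ =
    ∃[ x ] Nonzero x × InEigenspace G μ x ×
           (∀ y → InEigenspace G μ y → ∃[ c ] (∀ i → y i ≈ c * x i))

  Cyclotomic : ∀ {n} → Graph n → Set
  Cyclotomic G = ∀ μ → Eigenvalue G μ → - 2# ≤ μ × μ ≤ 2#

  IsIndex : ∀ {n} → Graph n → Carrier → Set
  IsIndex G ρ = Eigenvalue G ρ × (∀ μ → Eigenvalue G μ → μ ≤ ρ)

  IndexAbove2 : ∀ {n} → Graph n → Set
  IndexAbove2 G = ∃[ ρ ] IsIndex G ρ × 2# < ρ

  IndexAtMost2 : ∀ {n} → Graph n → Set
  IndexAtMost2 G = ∃[ ρ ] IsIndex G ρ × ρ ≤ 2#

  -- The graph without vertices has no index, but a one-vertex graph has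
  -- index 0, so the second clause never meets the empty graph when the
  -- first one holds.

  Minimal : ∀ {n} → Graph n → Set
  Minimal M = IndexAbove2 M × (∀ v → IndexAtMost2 (deleteVertex M v))

  -- Eigenvalues are counted with multiplicity.

  Salem : ∀ {n} → Graph n → Set
  Salem G =
    Bipartite G ×
    (∃[ ρ ] 2# < ρ × SimpleEigenvalue G ρ × SimpleEigenvalue G (- ρ) ×
            (∀ μ → Eigenvalue G μ → 2# < μ → μ ≈ ρ) ×
            (∀ μ → Eigenvalue G μ → μ < - 2# → μ ≈ - ρ))

{-# OPTIONS --safe #-}
module Submission where

-- Two orthogonal eigenvectors of G with eigenvalues above 2 are the only obstruction to being Salem:
-- they exist as soon as two eigenvalues (with multiplicity) exceed 2, and changing signs on one colour
-- class reflects the spectrum.  Call a vector x good if 2 |x|² < x · A x; a good vector supported on S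
-- forces G [ S ] to have index above 2, the index being the maximum of the Rayleigh quotient.
-- (a) Some combination of the two eigenvectors vanishes at v and is good, so G - v is not cyclotomic.
-- (b) The positive and the negative part of an eigenvector for an eigenvalue above 2 are good unless
-- zero, because the cross term in the form has a favourable sign; and if both eigenvectors have constant
-- sign, orthogonality makes their supports disjoint.  Either way there are good vectors with disjoint
-- supports.  The support of the first contains a minimal subgraph, whose complement contains the
-- support of the second.

open import Defs
open import Algebra.Bundles using (CommutativeRing)
open import Algebra.Solver.Ring.AlmostCommutativeRing
  using (fromCommutativeRing; _-Raw-AlmostCommutative⟶_)
open import Axiom.ExcludedMiddle using (ExcludedMiddle)
open import Data.Bool.Base using (true; false; if_then_else_)
open import Data.Fin.Base using (Fin; zero; suc)
open import Data.Fin.Properties using (_≟_)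
open import Data.Fin.Subset using (Subset; inside; outside; ∣_∣; ∁; ⁅_⁆; _∈_; _∉_; _⊆_; _⊂_)
  renaming (_-_ to _∖_)
open import Data.Fin.Subset.Induction using (⊂-wellFounded)
open import Data.Fin.Subset.Properties
  using (drop-there; x∉p⇒x∈∁p; x∈p⇒x∉∁p; x∉∁p⇒x∈p; x∈⁅x⁆; x∈⁅y⁆⇒x≡y; x≢y⇒x∉⁅y⁆;
         x∈p∧x≢y⇒x∈p-y; x∈p⇒p-x⊂p; p─q⊆p; _∈?_)
open import Data.Integer.Base as ℤ using (ℤ; +_; -[1+_]; _⊖_; _◃_)
import Data.Integer.Properties as ℤₚ
open import Data.Maybe.Base using (Maybe; just; nothing)
open import Data.Nat.Base as ℕ using (ℕ; zero; suc)
import Data.Nat.Properties as ℕₚ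
open import Data.Product.Base using (_×_; _,_; ∃; ∃-syntax; proj₁; proj₂)
import Data.Sign.Base as Sign
open import Data.Sum.Base using (_⊎_; inj₁; inj₂; [_,_]′; swap)
open import Data.Vec.Base using ([]; _∷_; here; there; tabulate)
open import Data.Vec.Functional using (Vector; head; tail) renaming (_∷_ to _∷ᶠ_)
open import Data.Vec.Properties using (lookup∘tabulate; []=⇒lookup; lookup⇒[]=)
open import Function.Base using (_∘_; id)
open import Induction.WellFounded using (Acc; acc)
open import Level using (0ℓ)
open import Relation.Binary.PropositionalEquality.Core as ≡ using (_≡_; _≢_)
open import Relation.Binary.Structures using (IsTotalOrder)
open import Relation.Nullary.Decidable using (dec-true)
open import Relation.Nullary.Decidable.Core using (Dec; yes; no; does)
open import Relation.Nullary.Negation.Core using (¬_; contradiction)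
import Algebra.Properties.Ring
import Algebra.Properties.Semiring.Mult.TCOptimised
import Algebra.Properties.Semiring.Sum
import Algebra.Solver.Ring
import Relation.Binary.Construct.NonStrictToStrict
import Relation.Binary.Reasoning.Setoid

private variable
  n : ℕ

-- A ring solver with integer coefficients over any commutative ring.

module IntegerSolver {c ℓ} (R : CommutativeRing c ℓ) where

  open CommutativeRing R hiding (zero)
  open Algebra.Properties.Ring ring
  open Algebra.Properties.Semiring.Mult.TCOptimised semiring renaming (_×_ to _×′_)
  open Relation.Binary.Reasoning.Setoid setoid

  -- With the optimised multiple, `1 ×′ 1#` reduces to `1#`, so `con (+ 0)` and `con (+ 1)` in
  -- solver goals are `0#` and `1#` definitionally.
  ⟦_⟧ : ℤ → Carrier
  ⟦ + n ⟧      = n ×′ 1#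
  ⟦ -[1+ n ] ⟧ = - (suc n ×′ 1#)

  ⟦⟧-⊖ : ∀ m n → ⟦ m ⊖ n ⟧ ≈ m ×′ 1# - n ×′ 1#
  ⟦⟧-⊖ zero    zero    = sym (-‿inverseʳ 0#)
  ⟦⟧-⊖ zero    (suc n) = sym (+-identityˡ _)
  ⟦⟧-⊖ (suc m) zero    = sym (trans (+-congˡ -0#≈0#) (+-identityʳ _))
  ⟦⟧-⊖ (suc m) (suc n) = begin
    ⟦ suc m ⊖ suc n ⟧         ≡⟨ ≡.cong ⟦_⟧ (ℤₚ.[1+m]⊖[1+n]≡m⊖n m n) ⟩
    ⟦ m ⊖ n ⟧                 ≈⟨ ⟦⟧-⊖ m n ⟩
    p - q                     ≈⟨ +-congʳ (+-identityʳ p) ⟨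
    -- Inserting `1# - 1#` restores the successors on both sides of the difference.
    p + 0# - q                ≈⟨ +-congʳ (+-congˡ (-‿inverseʳ 1#)) ⟨
    p + (1# - 1#) - q         ≈⟨ +-congʳ (+-assoc p 1# (- 1#)) ⟨
    p + 1# - 1# - q           ≈⟨ +-congʳ (+-congʳ (+-comm p 1#)) ⟩
    1# + p - 1# - q           ≈⟨ +-assoc (1# + p) (- 1#) (- q) ⟩
    1# + p + (- 1# - q)       ≈⟨ +-congˡ (-‿+-comm 1# q) ⟩
    1# + p - (1# + q)         ≈⟨ +-cong (1+× m 1#) (-‿cong (1+× n 1#)) ⟨
    suc m ×′ 1# - suc n ×′ 1#   ∎
    where p = m ×′ 1# ; q = n ×′ 1#

  ⟦⟧-neg : ∀ i → ⟦ ℤ.- i ⟧ ≈ - ⟦ i ⟧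
  ⟦⟧-neg (+ zero)   = sym -0#≈0#
  ⟦⟧-neg (+ suc n)  = refl
  ⟦⟧-neg (-[1+ n ]) = sym (-‿involutive _)

  ⟦⟧-+ : ∀ i j → ⟦ i ℤ.+ j ⟧ ≈ ⟦ i ⟧ + ⟦ j ⟧
  ⟦⟧-+ (+ m)      (+ n)      = ×-homo-+ 1# m n
  ⟦⟧-+ (+ m)      (-[1+ n ]) = ⟦⟧-⊖ m (suc n)
  ⟦⟧-+ (-[1+ m ]) (+ n)      = trans (⟦⟧-⊖ n (suc m)) (+-comm _ _)
  ⟦⟧-+ (-[1+ m ]) (-[1+ n ]) = begin
    - (suc (suc (m ℕ.+ n)) ×′ 1#)      ≡⟨ ≡.cong (λ k → - (suc k ×′ 1#)) (ℕₚ.+-suc m n) ⟨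
    - ((suc m ℕ.+ suc n) ×′ 1#)        ≈⟨ -‿cong (×-homo-+ 1# (suc m) (suc n)) ⟩
    - (suc m ×′ 1# + suc n ×′ 1#)       ≈⟨ -‿+-comm _ _ ⟨
    - (suc m ×′ 1#) - suc n ×′ 1#       ∎

  ⟦⟧-◃- : ∀ n → ⟦ Sign.- ◃ n ⟧ ≈ - (n ×′ 1#)
  ⟦⟧-◃- zero    = sym -0#≈0#
  ⟦⟧-◃- (suc n) = refl

  ⟦⟧-◃+ : ∀ n → ⟦ Sign.+ ◃ n ⟧ ≈ n ×′ 1#
  ⟦⟧-◃+ zero    = refl
  ⟦⟧-◃+ (suc n) = refl

  ⟦⟧-* : ∀ i j → ⟦ i ℤ.* j ⟧ ≈ ⟦ i ⟧ * ⟦ j ⟧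
  ⟦⟧-* (+ m)      (+ n)      = trans (⟦⟧-◃+ (m ℕ.* n)) (×1-homo-* m n)
  ⟦⟧-* (+ m)      (-[1+ n ]) =
    trans (⟦⟧-◃- (m ℕ.* suc n)) (trans (-‿cong (×1-homo-* m (suc n))) (-‿distribʳ-* _ _))
  ⟦⟧-* (-[1+ m ]) (+ n)      =
    trans (⟦⟧-◃- (suc m ℕ.* n)) (trans (-‿cong (×1-homo-* (suc m) n)) (-‿distribˡ-* _ _))
  ⟦⟧-* (-[1+ m ]) (-[1+ n ]) = begin
    (suc m ℕ.* suc n) ×′ 1#               ≈⟨ ×1-homo-* (suc m) (suc n) ⟩
    (suc m ×′ 1#) * (suc n ×′ 1#)          ≈⟨ -‿involutive _ ⟨
    - - ((suc m ×′ 1#) * (suc n ×′ 1#))    ≈⟨ -‿cong (-‿distribʳ-* _ _) ⟩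
    - ((suc m ×′ 1#) * - (suc n ×′ 1#))    ≈⟨ -‿distribˡ-* _ _ ⟩
    - (suc m ×′ 1#) * - (suc n ×′ 1#)      ∎

  ⟦⟧-morphism : ℤ.+-*-rawRing -Raw-AlmostCommutative⟶ fromCommutativeRing R
  ⟦⟧-morphism = record
    { ⟦_⟧    = ⟦_⟧
    ; +-homo = ⟦⟧-+
    ; *-homo = ⟦⟧-*
    ; -‿homo = ⟦⟧-neg
    ; 0-homo = refl
    ; 1-homo = refl
    }

  ⟦⟧-≟ : ∀ i j → Maybe (⟦ i ⟧ ≈ ⟦ j ⟧)
  ⟦⟧-≟ i j with i ℤₚ.≟ j
  ... | yes i≡j = just (reflexive (≡.cong ⟦_⟧ i≡j))
  ... | no _    = nothing

  open Algebra.Solver.Ring ℤ.+-*-rawRing (fromCommutativeRing R) ⟦⟧-morphism ⟦⟧-≟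
    public using (solve; _:=_; _:+_; _:*_; _:-_; :-_; con)

-- Ordered-field arithmetic, inner products and quadratic forms.

module LinearAlgebra (em : ExcludedMiddle 0ℓ) (ℝ : CompleteOrderedField) where

  open CompleteOrderedField ℝ hiding (zero) public
  open Spectrum ℝ public
  open Algebra.Properties.Ring ring public using (-0#≈0#; -‿involutive)
  open Algebra.Properties.Semiring.Sum semiring public hiding (sum)
  open IntegerSolver commutativeRing public
  open Relation.Binary.Reasoning.Setoid setoid public
  open IsTotalOrder isTotalOrder public using (total; antisym; ≤-respˡ-≈; ≤-respʳ-≈)
    renaming (reflexive to ≤-reflexive; trans to ≤-trans)
  open Relation.Binary.Construct.NonStrictToStrict _≈_ _≤_ public
    using (<⇒≤; <⇒≉; ≤∧≉⇒<)

  module Strict = Relation.Binary.Construct.NonStrictToStrict _≈_ _≤_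

  private variable
    a d x y z : Carrier

  -- Order

  <⇒≱ : x < y → ¬ (y ≤ x)
  <⇒≱ = Strict.<⇒≱ antisym

  ≰⇒> : ¬ (x ≤ y) → y < x
  ≰⇒> = Strict.≰⇒> sym ≤-reflexive total

  <-≤-trans : x < y → y ≤ z → x < z
  <-≤-trans = Strict.<-≤-trans sym ≤-trans antisym ≤-respʳ-≈

  ≤-<-trans : x ≤ y → y < z → x < z
  ≤-<-trans = Strict.≤-<-trans ≤-trans antisym ≤-respˡ-≈

  <-respʳ : y ≈ z → x < y → x < z
  <-respʳ y≈z x<y = <-≤-trans x<y (≤-reflexive y≈z)

  <-respˡ : x ≈ y → x < z → y < z
  <-respˡ x≈y x<z = ≤-<-trans (≤-reflexive (sym x≈y)) x<z

  ≤-or-> : ∀ x y → x ≤ y ⊎ y < x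
  ≤-or-> x y with em {x ≤ y}
  ... | yes x≤y = inj₁ x≤y
  ... | no  x≰y = inj₂ (≰⇒> x≰y)

  x≤y⇒0≤y-x : x ≤ y → 0# ≤ y - x
  x≤y⇒0≤y-x {x} x≤y = ≤-respˡ-≈ (-‿inverseʳ x) (+-monoˡ-≤ (- x) x≤y)

  -- The standard route to an inequality below: exhibit an evidently nonnegative `d` and leave its
  -- equality with the difference to the ring solver.
  ≤-by-difference : 0# ≤ d → d ≈ y - x → x ≤ y
  ≤-by-difference {d} {y} {x} 0≤d d≈y-x =
    ≤-respˡ-≈ (+-identityˡ x) (≤-respʳ-≈ d+x≈y (+-monoˡ-≤ x 0≤d))
    where
    d+x≈y : d + x ≈ y
    d+x≈y = trans (+-congʳ d≈y-x) (solve 2 (λ x y → y :- x :+ x := y) refl x y)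

  0≤-+ : 0# ≤ x → 0# ≤ y → 0# ≤ x + y
  0≤-+ {x} {y} 0≤x 0≤y =
    ≤-trans 0≤y (≤-respˡ-≈ (+-identityˡ y) (+-monoˡ-≤ y 0≤x))

  0<-+ : 0# < x → 0# ≤ y → 0# < x + y
  0<-+ {x} {y} 0<x 0≤y =
    <-≤-trans 0<x (≤-by-difference 0≤y (solve 2 (λ x y → y := x :+ y :- x) refl x y))

  -‿anti-≤ : x ≤ y → - y ≤ - x
  -‿anti-≤ {x} {y} x≤y =
    ≤-by-difference (x≤y⇒0≤y-x x≤y) (solve 2 (λ x y → y :- x := :- x :- :- y) refl x y)

  -‿anti-< : x < y → - y < - x
  -‿anti-< {x} {y} (x≤y , x≉y) = -‿anti-≤ x≤y , λ -y≈-x →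
    x≉y (trans (sym (-‿involutive x)) (trans (-‿cong (sym -y≈-x)) (-‿involutive y)))

  x<y⇒0<y-x : x < y → 0# < y - x
  x<y⇒0<y-x {x} {y} (x≤y , x≉y) = x≤y⇒0≤y-x x≤y , λ 0≈y-x → x≉y (begin
    x          ≈⟨ +-identityˡ x ⟨
    0# + x     ≈⟨ +-congʳ 0≈y-x ⟩
    y - x + x  ≈⟨ solve 2 (λ x y → y :- x :+ x := y) refl x y ⟩
    y          ∎)

  0≤x² : ∀ x → 0# ≤ x * x
  0≤x² x with total 0# x
  ... | inj₁ 0≤x = *-nonNeg 0≤x 0≤x
  ... | inj₂ x≤0 = ≤-respʳ-≈ (solve 1 (λ x → :- x :* :- x := x :* x) refl x) (*-nonNeg 0≤-x 0≤-x)
    where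
    0≤-x : 0# ≤ - x
    0≤-x = ≤-respˡ-≈ -0#≈0# (-‿anti-≤ x≤0)

  0<1 : 0# < 1#
  0<1 = ≤-respʳ-≈ (*-identityˡ 1#) (0≤x² 1#) , 0≉1

  0<2 : 0# < 2#
  0<2 = 0<-+ 0<1 (<⇒≤ 0<1)

  *-cancelˡ-0 : ¬ (x ≈ 0#) → x * y ≈ 0# → y ≈ 0#
  *-cancelˡ-0 {x} {y} x≉0 xy≈0 with inverse x x≉0
  ... | x⁻¹ , xx⁻¹≈1 = begin
    y              ≈⟨ *-identityˡ y ⟨
    1# * y         ≈⟨ *-congʳ xx⁻¹≈1 ⟨
    x * x⁻¹ * y    ≈⟨ solve 3 (λ x i y → x :* i :* y := i :* (x :* y)) refl x x⁻¹ y ⟩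
    x⁻¹ * (x * y)  ≈⟨ *-congˡ xy≈0 ⟩
    x⁻¹ * 0#       ≈⟨ zeroʳ x⁻¹ ⟩
    0#             ∎

  x²≈0⇒x≈0 : x * x ≈ 0# → x ≈ 0#
  x²≈0⇒x≈0 {x} x²≈0 with em {x ≈ 0#}
  ... | yes x≈0 = x≈0
  ... | no  x≉0 = *-cancelˡ-0 x≉0 x²≈0

  0<⇒≉0 : 0# < x → ¬ (x ≈ 0#)
  0<⇒≉0 0<x x≈0 = <⇒≉ 0<x (sym x≈0)

  0<-* : 0# < x → 0# < y → 0# < x * y
  0<-* 0<x 0<y = *-nonNeg (<⇒≤ 0<x) (<⇒≤ 0<y) , λ 0≈xy →
    0<⇒≉0 0<y (*-cancelˡ-0 (0<⇒≉0 0<x) (sym 0≈xy))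

  *-monoˡ-≤ : 0# ≤ a → x ≤ y → a * x ≤ a * y
  *-monoˡ-≤ {a} {x} {y} 0≤a x≤y = ≤-by-difference (*-nonNeg 0≤a (x≤y⇒0≤y-x x≤y))
    (solve 3 (λ a x y → a :* (y :- x) := a :* y :- a :* x) refl a x y)

  *-monoˡ-< : 0# < a → x < y → a * x < a * y
  *-monoˡ-< {a} {x} {y} 0<a x<y = *-monoˡ-≤ (<⇒≤ 0<a) (<⇒≤ x<y) , λ ax≈ay →
    0<⇒≉0 (0<-* 0<a (x<y⇒0<y-x x<y)) (begin
      a * (y - x)    ≈⟨ solve 3 (λ a x y → a :* (y :- x) := a :* y :- a :* x) refl a x y ⟩
      a * y - a * x  ≈⟨ +-congˡ (-‿cong ax≈ay) ⟩
      a * y - a * y  ≈⟨ -‿inverseʳ (a * y) ⟩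
      0#             ∎)

  *-cancelˡ-≤ : 0# < a → a * x ≤ a * y → x ≤ y
  *-cancelˡ-≤ {a} {x} {y} 0<a ax≤ay with ≤-or-> x y
  ... | inj₁ x≤y = x≤y
  ... | inj₂ y<x = contradiction ax≤ay (<⇒≱ (*-monoˡ-< 0<a y<x))

  0<-inverse : 0# < x → x * y ≈ 1# → 0# < y
  0<-inverse {x} {y} 0<x xy≈1 =
    *-cancelˡ-≤ 0<x (≤-respˡ-≈ (sym (zeroʳ x)) (≤-respʳ-≈ (sym xy≈1) (<⇒≤ 0<1))) ,
    λ 0≈y → 0≉1 (trans (sym (zeroʳ x)) (trans (*-congˡ 0≈y) xy≈1))

  -- Vectors and symmetric matrices

  ∑-nonNeg : (f : Vector Carrier n) → (∀ i → 0# ≤ f i) → 0# ≤ ∑[ i < n ] f i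
  ∑-nonNeg {zero}  f 0≤f = ≤-reflexive refl
  ∑-nonNeg {suc n} f 0≤f = 0≤-+ (0≤f zero) (∑-nonNeg (tail f) (0≤f ∘ suc))

  ∑-mono : (f g : Vector Carrier n) → (∀ i → f i ≤ g i) → ∑[ i < n ] f i ≤ ∑[ i < n ] g i
  ∑-mono {zero}  f g f≤g = ≤-reflexive refl
  ∑-mono {suc n} f g f≤g = ≤-by-difference
    (0≤-+ (x≤y⇒0≤y-x (f≤g zero)) (x≤y⇒0≤y-x (∑-mono (tail f) (tail g) (f≤g ∘ suc))))
    (solve 4 (λ f₀ g₀ f g → (g₀ :- f₀) :+ (g :- f) := g₀ :+ g :- (f₀ :+ f)) refl _ _ _ _)

  ∑-zero : (f : Vector Carrier n) → (∀ i → f i ≈ 0#) → ∑[ i < n ] f i ≈ 0#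
  ∑-zero {n} f f≈0 = trans (sum-cong-≋ f≈0) (sum-replicate-zero n)

  ∑-nonNeg-zero : (f : Vector Carrier n) → (∀ i → 0# ≤ f i) →
                  ∑[ i < n ] f i ≈ 0# → ∀ i → f i ≈ 0#
  ∑-nonNeg-zero {suc n} f 0≤f ∑f≈0 = λ where
      zero    → f₀≈0
      (suc i) → ∑-nonNeg-zero (tail f) (0≤f ∘ suc) ∑tail≈0 i
    where
    f₀≈0 : f zero ≈ 0#
    f₀≈0 = antisym
      (≤-by-difference (∑-nonNeg (tail f) (0≤f ∘ suc))
        (trans (solve 2 (λ x y → y := x :+ y :- x) refl _ _) (+-congʳ ∑f≈0)))
      (0≤f zero)
    ∑tail≈0 : ∑[ i < n ] f (suc i) ≈ 0#
    ∑tail≈0 = trans (sym (+-identityˡ _)) (trans (+-congʳ (sym f₀≈0)) ∑f≈0)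

  infix 9 _·_

  _·_ : Vector Carrier n → Vector Carrier n → Carrier
  _·_ {n} x y = ∑[ i < n ] (x i * y i)

  lincomb : Carrier → Vector Carrier n → Carrier → Vector Carrier n → Vector Carrier n
  lincomb a x b y i = a * x i + b * y i

  Matrix : ℕ → Set
  Matrix n = Fin n → Fin n → Carrier

  Symmetric : Matrix n → Set
  Symmetric B = ∀ i j → B i j ≈ B j i

  form : Matrix n → Vector Carrier n → Carrier
  form B x = x · (B *ᵥ x)

  ·-comm : (x y : Vector Carrier n) → x · y ≈ y · x
  ·-comm x y = sum-cong-≋ (λ i → *-comm (x i) (y i))

  ·-congˡ : (x {y} {z} : Vector Carrier n) → (∀ i → y i ≈ z i) → x · y ≈ x · z
  ·-congˡ x y≈z = sum-cong-≋ (λ i → *-congˡ (y≈z i))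

  ·-cong : {x x′ y y′ : Vector Carrier n} →
           (∀ i → x i ≈ x′ i) → (∀ i → y i ≈ y′ i) → x · y ≈ x′ · y′
  ·-cong x≈x′ y≈y′ = sum-cong-≋ (λ i → *-cong (x≈x′ i) (y≈y′ i))

  ·-scaleʳ : ∀ (x : Vector Carrier n) a y → x · (λ i → a * y i) ≈ a * x · y
  ·-scaleʳ x a y = trans
    (sum-cong-≋ (λ i → solve 3 (λ x a y → x :* (a :* y) := a :* (x :* y)) refl (x i) a (y i)))
    (sym (*-distribˡ-sum a (λ i → x i * y i)))

  ·-lincombʳ : ∀ (x : Vector Carrier n) a y b z → x · lincomb a y b z ≈ a * x · y + b * x · z
  ·-lincombʳ x a y b z = begin
    x · lincomb a y b z
      ≈⟨ sum-cong-≋ (λ i → distribˡ (x i) (a * y i) (b * z i)) ⟩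
    ∑[ i < _ ] (x i * (a * y i) + x i * (b * z i))
      ≈⟨ ∑-distrib-+ (λ i → x i * (a * y i)) (λ i → x i * (b * z i)) ⟩
    x · (λ i → a * y i) + x · (λ i → b * z i)
      ≈⟨ +-cong (·-scaleʳ x a y) (·-scaleʳ x b z) ⟩
    a * x · y + b * x · z  ∎

  ·-lincombˡ : ∀ a (x : Vector Carrier n) b y z → lincomb a x b y · z ≈ a * x · z + b * y · z
  ·-lincombˡ a x b y z = begin
    lincomb a x b y · z    ≈⟨ ·-comm (lincomb a x b y) z ⟩
    z · lincomb a x b y    ≈⟨ ·-lincombʳ z a x b y ⟩
    a * z · x + b * z · y  ≈⟨ +-cong (*-congˡ (·-comm z x)) (*-congˡ (·-comm z y)) ⟩
    a * x · z + b * y · z  ∎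

  ·-zeroʳ : (x y : Vector Carrier n) → (∀ i → y i ≈ 0#) → x · y ≈ 0#
  ·-zeroʳ x y y≈0 = ∑-zero _ (λ i → trans (*-congˡ (y≈0 i)) (zeroʳ (x i)))

  0≤x·x : (x : Vector Carrier n) → 0# ≤ x · x
  0≤x·x x = ∑-nonNeg _ (λ i → 0≤x² (x i))

  x·x≈0⇒x≈0 : (x : Vector Carrier n) → x · x ≈ 0# → ∀ i → x i ≈ 0#
  x·x≈0⇒x≈0 x x·x≈0 i = x²≈0⇒x≈0 (∑-nonNeg-zero _ (λ i → 0≤x² (x i)) x·x≈0 i)

  Nonzero⇒0<x·x : (x : Vector Carrier n) → Nonzero x → 0# < x · x
  Nonzero⇒0<x·x x x≉0 = 0≤x·x x , λ 0≈x·x → x≉0 (x·x≈0⇒x≈0 x (sym 0≈x·x))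

  -- The mixed term stays split into two equal summands, the shape shared with `form-lincomb`, so
  -- that both expansions can be rewritten alike.
  lincomb-norm : ∀ a (x : Vector Carrier n) b y →
    lincomb a x b y · lincomb a x b y
      ≈ a * (a * x · x) + (a * (b * x · y) + a * (b * x · y)) + b * (b * y · y)
  lincomb-norm a x b y = begin
    u · u
      ≈⟨ ·-lincombˡ a x b y u ⟩
    a * x · u + b * y · u
      ≈⟨ +-cong (*-congˡ (·-lincombʳ x a x b y)) (*-congˡ (·-lincombʳ y a x b y)) ⟩
    a * (a * x · x + b * x · y) + b * (a * y · x + b * y · y)
      ≈⟨ +-congˡ (*-congˡ (+-congʳ (*-congˡ (·-comm y x)))) ⟩
    a * (a * x · x + b * x · y) + b * (a * x · y + b * y · y)
      ≈⟨ solve 5 (λ a b xx xy yy →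
           a :* (a :* xx :+ b :* xy) :+ b :* (a :* xy :+ b :* yy) :=
           a :* (a :* xx) :+ (a :* (b :* xy) :+ a :* (b :* xy)) :+ b :* (b :* yy))
         refl a b (x · x) (x · y) (y · y) ⟩
    _ ∎
    where u = lincomb a x b y

  -- The vector `(x · x) y - (x · y) x` has squared norm `x · x` times the gap between the two
  -- sides. If `x · x` vanishes, so does `x`, and both sides are zero.
  cauchy-schwarz : (x y : Vector Carrier n) → x · y * x · y ≤ x · x * y · y
  cauchy-schwarz x y with em {x · x ≈ 0#}
  ... | yes x·x≈0 = ≤-reflexive (begin
    x · y * x · y  ≈⟨ *-congʳ (trans (·-comm x y) (·-zeroʳ y x (x·x≈0⇒x≈0 x x·x≈0))) ⟩
    0# * x · y     ≈⟨ zeroˡ (x · y) ⟩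
    0#             ≈⟨ zeroˡ (y · y) ⟨
    0# * y · y     ≈⟨ *-congʳ x·x≈0 ⟨
    x · x * y · y  ∎)
  ... | no  x·x≉0 = *-cancelˡ-≤ (0≤x·x x , x·x≉0 ∘ sym) (≤-by-difference (0≤x·x u)
      (trans (lincomb-norm (x · x) y (- (x · y)) x)
        (trans (+-congʳ (+-congˡ (+-cong (*-congˡ (*-congˡ (·-comm y x))) (*-congˡ (*-congˡ (·-comm y x))))))
          (solve 3 (λ xx xy yy →
             xx :* (xx :* yy) :+ (xx :* (:- xy :* xy) :+ xx :* (:- xy :* xy)) :+ :- xy :* (:- xy :* xx)
               := xx :* (xx :* yy) :- xx :* (xy :* xy))
           refl (x · x) (x · y) (y · y)))))
    where u = lincomb (x · x) y (- (x · y)) x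

  *ᵥ-lincomb : ∀ (B : Matrix n) a x b y i →
               (B *ᵥ lincomb a x b y) i ≈ lincomb a (B *ᵥ x) b (B *ᵥ y) i
  *ᵥ-lincomb B a x b y i = ·-lincombʳ (B i) a x b y

  *ᵥ-cong : ∀ (B : Matrix n) {x y} → (∀ i → x i ≈ y i) → ∀ i → (B *ᵥ x) i ≈ (B *ᵥ y) i
  *ᵥ-cong B x≈y i = ·-congˡ (B i) x≈y

  form-cong : ∀ (B : Matrix n) {x y} → (∀ i → x i ≈ y i) → form B x ≈ form B y
  form-cong B x≈y = ·-cong x≈y (*ᵥ-cong B x≈y)

  self-adjoint : (B : Matrix n) → Symmetric B → ∀ x y → x · (B *ᵥ y) ≈ y · (B *ᵥ x)
  self-adjoint {n} B B-sym x y = begin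
    ∑[ i < n ] (x i * ∑[ j < n ] (B i j * y j))    ≈⟨ sum-cong-≋ (λ i → *-distribˡ-sum (x i) (λ j → B i j * y j)) ⟩
    ∑[ i < n ] ∑[ j < n ] (x i * (B i j * y j))    ≈⟨ ∑-comm (λ i j → x i * (B i j * y j)) ⟩
    ∑[ j < n ] ∑[ i < n ] (x i * (B i j * y j))
      ≈⟨ sum-cong-≋ (λ j → sum-cong-≋ (λ i → trans (*-congˡ (*-congʳ (B-sym i j)))
           (solve 3 (λ x b y → x :* (b :* y) := y :* (b :* x)) refl (x i) (B j i) (y j)))) ⟩
    ∑[ j < n ] ∑[ i < n ] (y j * (B j i * x i))    ≈⟨ sum-cong-≋ (λ j → *-distribˡ-sum (y j) (λ i → B j i * x i)) ⟨
    y · (B *ᵥ x)                                   ∎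

  form-lincomb : (B : Matrix n) → Symmetric B → ∀ a x b y →
    form B (lincomb a x b y)
      ≈ a * (a * form B x) + (a * (b * y · (B *ᵥ x)) + a * (b * y · (B *ᵥ x))) + b * (b * form B y)
  form-lincomb B B-sym a x b y = begin
    u · (B *ᵥ u)
      ≈⟨ ·-congˡ u (*ᵥ-lincomb B a x b y) ⟩
    u · lincomb a (B *ᵥ x) b (B *ᵥ y)
      ≈⟨ ·-lincombʳ u a (B *ᵥ x) b (B *ᵥ y) ⟩
    a * u · (B *ᵥ x) + b * u · (B *ᵥ y)
      ≈⟨ +-cong (*-congˡ (·-lincombˡ a x b y (B *ᵥ x))) (*-congˡ (·-lincombˡ a x b y (B *ᵥ y))) ⟩
    a * (a * form B x + b * y · (B *ᵥ x)) + b * (a * x · (B *ᵥ y) + b * form B y)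
      ≈⟨ +-congˡ (*-congˡ (+-congʳ (*-congˡ (self-adjoint B B-sym x y)))) ⟩
    a * (a * form B x + b * y · (B *ᵥ x)) + b * (a * y · (B *ᵥ x) + b * form B y)
      ≈⟨ solve 5 (λ a b xx xy yy →
           a :* (a :* xx :+ b :* xy) :+ b :* (a :* xy :+ b :* yy) :=
           a :* (a :* xx) :+ (a :* (b :* xy) :+ a :* (b :* xy)) :+ b :* (b :* yy))
         refl a b (form B x) (y · (B *ᵥ x)) (form B y) ⟩
    _ ∎
    where u = lincomb a x b y

  -- Needed for the supremum of the Rayleigh quotients to exist. Here `β` is the squared Frobenius
  -- norm: Cauchy-Schwarz on each row gives `|Bx|² ≤ β|x|²`, and expanding `0 ≤ |x - Bx|²` bounds
  -- `2 x · Bx` by `|x|² + |Bx|²`.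
  form-bounded : (B : Matrix n) → ∃[ c ] (∀ x → form B x ≤ c * x · x)
  form-bounded {n} B = 1# + β , λ x →
    let Bx = B *ᵥ x
        |Bx|²≤β|x|² : Bx · Bx ≤ β * x · x
        |Bx|²≤β|x|² = ≤-respʳ-≈ (sym (*-distribʳ-sum (x · x) (λ i → B i · B i)))
          (∑-mono _ _ (λ i → cauchy-schwarz (B i) x))
        0≤β|x|² = ≤-trans (0≤x·x Bx) |Bx|²≤β|x|²
    in *-cancelˡ-≤ 0<2 (≤-by-difference
         (0≤-+ (0≤-+ (0≤-+ (0≤x·x (lincomb 1# x (- 1#) Bx)) (x≤y⇒0≤y-x |Bx|²≤β|x|²)) (0≤x·x x)) 0≤β|x|²)
         (trans (+-congʳ (+-congʳ (+-congʳ (lincomb-norm 1# x (- 1#) Bx))))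
           (solve 4 (λ xx xBx BxBx β → let i = con (+ 1) in
              i :* (i :* xx) :+ (i :* (:- i :* xBx) :+ i :* (:- i :* xBx)) :+ :- i :* (:- i :* BxBx)
                :+ (β :* xx :- BxBx) :+ xx :+ β :* xx
                := (i :+ i) :* ((i :+ β) :* xx) :- (i :+ i) :* xBx)
            refl (x · x) (x · Bx) (Bx · Bx) β)))
    where β = ∑[ i < n ] (B i · B i)

-- The maximum of the Rayleigh quotient exists and is an eigenvalue.

module Rayleigh (em : ExcludedMiddle 0ℓ) (ℝ : CompleteOrderedField) where

  open LinearAlgebra em ℝ public

  -- Otherwise the form would be negative at (k + 1) x - g B x, where g = |B x|² and k = form B (B x).
  semidefinite-kernel : (B : Matrix n) → Symmetric B → (∀ x → 0# ≤ form B x) →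
                        ∀ x → form B x ≤ 0# → ∀ i → (B *ᵥ x) i ≈ 0#
  semidefinite-kernel B B-sym 0≤form x form≤0 = x·x≈0⇒x≈0 w g≈0
    where
    w = B *ᵥ x
    g = w · w
    k = form B w

    0≤-g²[k+2] : 0# ≤ - (g * g * (k + 2#))
    0≤-g²[k+2] = ≤-respʳ-≈ (begin
      form B (lincomb (k + 1#) x (- g) w)
        ≈⟨ form-lincomb B B-sym (k + 1#) x (- g) w ⟩
      _ ≈⟨ +-congʳ (+-congʳ (*-congˡ (*-congˡ (antisym form≤0 (0≤form x))))) ⟩
      _ ≈⟨ solve 2 (λ g k → let i = con (+ 1) in
             (k :+ i) :* ((k :+ i) :* con (+ 0))
               :+ ((k :+ i) :* (:- g :* g) :+ (k :+ i) :* (:- g :* g)) :+ :- g :* (:- g :* k)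
             := :- (g :* g :* (k :+ (i :+ i))))
           refl g k ⟩
      - (g * g * (k + 2#))  ∎) (0≤form (lincomb (k + 1#) x (- g) w))

    0<k+2 : 0# < k + 2#
    0<k+2 = <-respʳ (+-comm 2# k) (0<-+ 0<2 (0≤form w))

    g≈0 : g ≈ 0#
    g≈0 = x²≈0⇒x≈0 (antisym
      (*-cancelˡ-≤ 0<k+2 (≤-by-difference 0≤-g²[k+2]
        (solve 2 (λ g k → :- (g :* g :* k) := k :* con (+ 0) :- k :* (g :* g)) refl g (k + 2#))))
      (0≤x² g))

  -- Uniform positive definiteness: `1 / K` is a positive lower bound for the Rayleigh quotient.
  Coercive : Matrix n → Set
  Coercive B = ∃[ K ] 0# < K × (∀ x → x · x ≤ K * form B x)

  private
    -- To be read with `s` the head and `y` the tail of a vector, `t = r · y`, `q = form D y`, and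
    -- `Y`, `N` the squared norms of `y` and `r`. Completing the square turns `p` times the form
    -- into `u * u + S`; substituting `p * s = u - t` then leaves the terms on the left.
    coercive-identity : ∀ p s t q Y K N →
      let u = p * s + t
          S = p * q - t * t
          M = (N + N) + p * p
          L = 2# + M * K
      in (u + t) * (u + t) + (S + S) + M * K * (u * u) + M * (K * S - Y)
           + ((N * Y - t * t) + (N * Y - t * t))
         ≈ p * L * (p * (s * s) + (s * t + s * t) + q) - p * p * (s * s + Y)
    coercive-identity = solve 7 (λ p s t q Y K N →
               let u = p :* s :+ t
                   S = p :* q :- t :* t
                   M = (N :+ N) :+ p :* p
                   L = (con (+ 1) :+ con (+ 1)) :+ M :* K
               in (u :+ t) :* (u :+ t) :+ (S :+ S) :+ M :* K :* (u :* u) :+ M :* (K :* S :- Y)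
                    :+ ((N :* Y :- t :* t) :+ (N :* Y :- t :* t))
                  := p :* L :* (p :* (s :* s) :+ (s :* t :+ s :* t) :+ q) :- p :* p :* (s :* s :+ Y))
      refl

  private
    -- After multiplication by `p * p`, the gap between the two sides is the left side of
    -- `coercive-identity`, each term of which is nonnegative under these hypotheses.
    coercive-bound : ∀ p p⁻¹ s t q Y K N → 0# < p → p * p⁻¹ ≈ 1# → 0# < K →
      0# ≤ N → 0# ≤ Y → t * t ≤ N * Y → Y ≤ K * (p * q - t * t) →
      s * s + Y ≤ p⁻¹ * (2# + ((N + N) + p * p) * K) * (p * (s * s) + (s * t + s * t) + q)
    coercive-bound p p⁻¹ s t q Y K N 0<p pp⁻¹≈1 0<K 0≤N 0≤Y t²≤NY Y≤KS =
      *-cancelˡ-≤ (0<-* 0<p 0<p) (≤-by-difference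
        (0≤-+ (0≤-+ (0≤-+ (0≤-+ (0≤x² (u + t)) (0≤-+ 0≤S 0≤S))
          (*-nonNeg (*-nonNeg 0≤M (<⇒≤ 0<K)) (0≤x² u)))
          (*-nonNeg 0≤M (x≤y⇒0≤y-x Y≤KS)))
          (0≤-+ (x≤y⇒0≤y-x t²≤NY) (x≤y⇒0≤y-x t²≤NY)))
        (begin
      (u + t) * (u + t) + (S + S) + M * K * (u * u) + M * (K * S - Y)
        + ((N * Y - t * t) + (N * Y - t * t))
        ≈⟨ coercive-identity p s t q Y K N ⟩
      p * L * F - p * p * (s * s + Y)
        ≈⟨ +-congʳ (*-identityˡ (p * L * F)) ⟨
      1# * (p * L * F) - p * p * (s * s + Y)
        ≈⟨ +-congʳ (*-congʳ pp⁻¹≈1) ⟨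
      p * p⁻¹ * (p * L * F) - p * p * (s * s + Y)
        ≈⟨ +-congʳ (solve 4 (λ p i L F → p :* i :* (p :* L :* F) := p :* p :* (i :* L :* F))
             refl p p⁻¹ L F) ⟩
      p * p * (p⁻¹ * L * F) - p * p * (s * s + Y)  ∎))
      where
      u = p * s + t
      S = p * q - t * t
      M = (N + N) + p * p
      L = 2# + M * K
      F = p * (s * s) + (s * t + s * t) + q
      0≤M : 0# ≤ M
      0≤M = 0≤-+ (0≤-+ 0≤N 0≤N) (0≤x² p)
      0≤S : 0# ≤ S
      0≤S = *-cancelˡ-≤ 0<K (≤-respˡ-≈ (sym (zeroʳ K)) (≤-trans 0≤Y Y≤KS))

  -- S is p times the usual Schur complement of the pivot p, so that no division is needed.
  private module SchurComplement {n} (B : Matrix (suc n)) (B-sym : Symmetric B) where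

    p : Carrier
    p = B zero zero

    r : Vector Carrier n
    r j = B zero (suc j)

    D : Matrix n
    D i j = B (suc i) (suc j)

    S : Matrix n
    S i j = p * D i j + (- r i) * r j

    S-sym : Symmetric S
    S-sym i j = +-cong (*-congˡ (B-sym (suc i) (suc j)))
      (solve 2 (λ x y → :- x :* y := :- y :* x) refl (r i) (r j))

    form-split : ∀ x → let s = head x ; y = tail x in
                 form B x ≈ p * (s * s) + (s * r · y + s * r · y) + form D y
    form-split x = begin
      s * (p * s + r · y) + y · (λ i → B (suc i) zero * s + (D *ᵥ y) i)
        ≈⟨ +-congˡ (·-congˡ y (λ i → +-cong
             (trans (*-congʳ (B-sym (suc i) zero)) (*-comm (r i) s))
             (sym (*-identityˡ _)))) ⟩
      s * (p * s + r · y) + y · lincomb s r 1# (D *ᵥ y)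
        ≈⟨ +-congˡ (·-lincombʳ y s r 1# (D *ᵥ y)) ⟩
      s * (p * s + r · y) + (s * y · r + 1# * form D y)
        ≈⟨ +-congˡ (+-congʳ (*-congˡ (·-comm y r))) ⟩
      s * (p * s + r · y) + (s * r · y + 1# * form D y)
        ≈⟨ solve 4 (λ p s t q → s :* (p :* s :+ t) :+ (s :* t :+ con (+ 1) :* q) :=
             p :* (s :* s) :+ (s :* t :+ s :* t) :+ q) refl p s (r · y) (form D y) ⟩
      p * (s * s) + (s * r · y + s * r · y) + form D y  ∎
      where s = head x ; y = tail x

    form-S : ∀ y → form S y ≈ p * form D y - r · y * r · y
    form-S y = begin
      y · (S *ᵥ y)
        ≈⟨ ·-congˡ y (λ i → trans (·-lincombˡ p (D i) (- r i) r y)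
             (+-congˡ (solve 2 (λ x t → :- x :* t := :- t :* x) refl (r i) (r · y)))) ⟩
      y · lincomb p (D *ᵥ y) (- r · y) r
        ≈⟨ ·-lincombʳ y p (D *ᵥ y) (- r · y) r ⟩
      p * form D y + - r · y * y · r
        ≈⟨ +-congˡ (*-congˡ (·-comm y r)) ⟩
      p * form D y + - r · y * r · y
        ≈⟨ solve 2 (λ t q → q :+ :- t :* t := q :- t :* t) refl (r · y) (p * form D y) ⟩
      p * form D y - r · y * r · y  ∎

    form-e₀ : form B (1# ∷ᶠ λ _ → 0#) ≈ p
    form-e₀ = begin
      form B (1# ∷ᶠ λ _ → 0#)
        ≈⟨ form-split (1# ∷ᶠ λ _ → 0#) ⟩
      p * (1# * 1#) + (1# * r · 0ᵥ + 1# * r · 0ᵥ) + form D 0ᵥ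
        ≈⟨ +-cong (+-congˡ (+-cong (*-congˡ r·0≈0) (*-congˡ r·0≈0)))
             (trans (·-comm 0ᵥ (D *ᵥ 0ᵥ)) (·-zeroʳ (D *ᵥ 0ᵥ) 0ᵥ (λ _ → refl))) ⟩
      p * (1# * 1#) + (1# * 0# + 1# * 0#) + 0#
        ≈⟨ solve 1 (λ p → let i = con (+ 1) ; o = con (+ 0) in
             p :* (i :* i) :+ (i :* o :+ i :* o) :+ o := p) refl p ⟩
      p  ∎
      where
      0ᵥ : Vector Carrier n
      0ᵥ _ = 0#
      r·0≈0 : r · 0ᵥ ≈ 0#
      r·0≈0 = ·-zeroʳ r 0ᵥ (λ _ → refl)

    -- The head is chosen to minimise form B over all vectors with tail p y.
    form-lift : ∀ y → form B (- r · y ∷ᶠ λ i → p * y i) ≈ p * form S y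
    form-lift y = begin
      form B (- r · y ∷ᶠ py)
        ≈⟨ form-split (- r · y ∷ᶠ py) ⟩
      p * (- r · y * - r · y) + (- r · y * r · py + - r · y * r · py) + form D py
        ≈⟨ +-cong (+-congˡ (+-cong (*-congˡ (·-scaleʳ r p y)) (*-congˡ (·-scaleʳ r p y)))) form-py ⟩
      p * (- r · y * - r · y) + (- r · y * (p * r · y) + - r · y * (p * r · y)) + p * (p * form D y)
        ≈⟨ solve 3 (λ p t q → p :* (:- t :* :- t) :+ (:- t :* (p :* t) :+ :- t :* (p :* t)) :+ p :* (p :* q)
             := p :* (p :* q :- t :* t)) refl p (r · y) (form D y) ⟩
      p * (p * form D y - r · y * r · y)
        ≈⟨ *-congˡ (form-S y) ⟨
      p * form S y  ∎
      where
      py : Vector Carrier n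
      py i = p * y i
      form-py : form D py ≈ p * (p * form D y)
      form-py = begin
        py · (D *ᵥ py)             ≈⟨ ·-congˡ py (λ i → ·-scaleʳ (D i) p y) ⟩
        py · (λ i → p * (D *ᵥ y) i) ≈⟨ ·-scaleʳ py p (D *ᵥ y) ⟩
        p * py · (D *ᵥ y)          ≈⟨ *-congˡ (·-comm py (D *ᵥ y)) ⟩
        p * (D *ᵥ y) · py          ≈⟨ *-congˡ (·-scaleʳ (D *ᵥ y) p y) ⟩
        p * (p * (D *ᵥ y) · y)     ≈⟨ *-congˡ (*-congˡ (·-comm (D *ᵥ y) y)) ⟩
        p * (p * form D y)         ∎

    -- The constant is the one of `coercive-bound`, whose hypothesis on `t * t` is Cauchy-Schwarz
    -- for `r` and the tail.
    coercive-lift : 0# < p → Coercive S → Coercive B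
    coercive-lift 0<p (K , 0<K , y·y≤KS) with inverse p (0<⇒≉0 0<p)
    ... | p⁻¹ , pp⁻¹≈1 =
      p⁻¹ * (2# + ((r · r + r · r) + p * p) * K) ,
      0<-* (0<-inverse 0<p pp⁻¹≈1) (0<-+ 0<2 (*-nonNeg
        (0≤-+ (0≤-+ (0≤x·x r) (0≤x·x r)) (0≤x² p)) (<⇒≤ 0<K))) ,
      λ x → let y = tail x in
        ≤-respʳ-≈ (*-congˡ (sym (form-split x)))
          (coercive-bound p p⁻¹ (head x) (r · y) (form D y) (y · y) K (r · r) 0<p pp⁻¹≈1 0<K
            (0≤x·x r) (0≤x·x y) (cauchy-schwarz r y)
            (≤-respʳ-≈ (*-congˡ (form-S y)) (y·y≤KS y)))

  -- Symmetric elimination stands in for compactness of the unit sphere. A pivot `p ≤ 0` is the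
  -- value of the form at the first basis vector; with a positive pivot, either alternative for the
  -- Schur complement lifts to `B`.
  coercive-or-nonpositive : (B : Matrix n) → Symmetric B →
                            Coercive B ⊎ (∃[ x ] Nonzero x × form B x ≤ 0#)
  coercive-or-nonpositive {zero}  B B-sym =
    -- In dimension zero both sides vanish, so any positive constant serves.
    inj₁ (1# , 0<1 , λ x → ≤-reflexive (sym (*-identityˡ 0#)))
  coercive-or-nonpositive {suc n} B B-sym = split (≤-or-> p 0#) (coercive-or-nonpositive S S-sym)
    where
    open SchurComplement B B-sym
    split : p ≤ 0# ⊎ 0# < p → Coercive S ⊎ (∃[ y ] Nonzero y × form S y ≤ 0#) →
            Coercive B ⊎ (∃[ x ] Nonzero x × form B x ≤ 0#)
    split (inj₁ p≤0) _ = inj₂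
      ((1# ∷ᶠ λ _ → 0#) , (λ e₀≈0 → 0≉1 (sym (e₀≈0 zero))) , ≤-respˡ-≈ (sym form-e₀) p≤0)
    split (inj₂ 0<p) (inj₁ S-coercive) = inj₁ (coercive-lift 0<p S-coercive)
    split (inj₂ 0<p) (inj₂ (y , y≉0 , S≤0)) = inj₂
      ((- r · y ∷ᶠ λ i → p * y i) , (λ x≈0 → y≉0 (λ i → *-cancelˡ-0 (0<⇒≉0 0<p) (x≈0 (suc i)))) ,
       ≤-respˡ-≈ (sym (form-lift y)) (≤-respʳ-≈ (zeroʳ p) (*-monoˡ-≤ (<⇒≤ 0<p) S≤0)))

  private
    -- The identity matrix, by recursion on the indices so that `δ-identity` can follow the
    -- recursion of the sum.
    δ : Matrix n
    δ zero    zero    = 1#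
    δ zero    (suc j) = 0#
    δ (suc i) zero    = 0#
    δ (suc i) (suc j) = δ i j

    δ-sym : Symmetric (δ {n})
    δ-sym zero    zero    = refl
    δ-sym zero    (suc j) = refl
    δ-sym (suc i) zero    = refl
    δ-sym (suc i) (suc j) = δ-sym i j

    δ-identity : ∀ (x : Vector Carrier n) i → (δ *ᵥ x) i ≈ x i
    δ-identity x zero    = trans
      (+-cong (*-identityˡ _) (∑-zero _ (λ j → zeroˡ (x (suc j))))) (+-identityʳ _)
    δ-identity x (suc i) = trans (+-cong (zeroˡ _) (δ-identity (tail x) i)) (+-identityˡ _)

  Eigenvector : Matrix n → Carrier → Vector Carrier n → Set
  Eigenvector B μ x = ∀ i → (B *ᵥ x) i ≈ μ * x i

  eigenvector-form : ∀ (B : Matrix n) {μ x} → Eigenvector B μ x → form B x ≈ μ * x · x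
  eigenvector-form B {μ} {x} Bx≈μx = trans (·-congˡ x Bx≈μx) (·-scaleʳ x μ x)

  -- All numbers lying below some Rayleigh quotient, with the norm multiplied out. This set has the
  -- same upper bounds as the quotients themselves.
  Quotient : Matrix n → Carrier → Set
  Quotient B s = ∃[ x ] Nonzero x × s * x · x ≤ form B x

  rayleigh-quotient : ∀ (B : Matrix n) x → Nonzero x → ∃[ s ] s * x · x ≈ form B x
  rayleigh-quotient B x x≉0 = let i , xxi≈1 = inverse (x · x) (0<⇒≉0 (Nonzero⇒0<x·x x x≉0)) in
    form B x * i , (begin
      form B x * i * x · x    ≈⟨ solve 3 (λ f i n → f :* i :* n := n :* i :* f) refl (form B x) i (x · x) ⟩
      x · x * i * form B x    ≈⟨ *-congʳ xxi≈1 ⟩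
      1# * form B x           ≈⟨ *-identityˡ (form B x) ⟩
      form B x                ∎)

  cancel-norm : ∀ {a b} (x : Vector Carrier n) → Nonzero x → a * x · x ≤ b * x · x → a ≤ b
  cancel-norm {a = a} {b} x x≉0 le = *-cancelˡ-≤ (Nonzero⇒0<x·x x x≉0)
    (≤-respˡ-≈ (*-comm a (x · x)) (≤-respʳ-≈ (*-comm b (x · x)) le))

  -- ρ I - B is positive semidefinite; if it were coercive then ρ could be lowered, so it has a kernel.
  module Supremum {n} (B : Matrix n) (B-sym : Symmetric B) (ρ : Carrier)
    (upper : UpperBound (Quotient B) ρ)
    (least : ∀ b → UpperBound (Quotient B) b → ρ ≤ b) where

    form≤ρ : ∀ x → form B x ≤ ρ * x · x
    form≤ρ x with em {∀ i → x i ≈ 0#}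
    ... | yes x≈0 = ≤-reflexive (begin
      x · (B *ᵥ x)   ≈⟨ ·-comm x (B *ᵥ x) ⟩
      (B *ᵥ x) · x   ≈⟨ ·-zeroʳ (B *ᵥ x) x x≈0 ⟩
      0#             ≈⟨ zeroʳ ρ ⟨
      ρ * 0#         ≈⟨ *-congˡ (·-zeroʳ x x x≈0) ⟨
      ρ * x · x      ∎)
    ... | no x≉0 = let s , eq = rayleigh-quotient B x x≉0 in
      ≤-respˡ-≈ eq (≤-respˡ-≈ (*-comm (x · x) s) (≤-respʳ-≈ (*-comm (x · x) ρ)
        (*-monoˡ-≤ (0≤x·x x) (upper s (x , x≉0 , ≤-reflexive eq)))))

    -- This is `ρ I - B`; each row is a `lincomb` of rows of `δ` and `B`, so bilinearity gives its
    -- action.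
    T : Matrix n
    T i j = ρ * δ i j + (- 1#) * B i j

    T-sym : Symmetric T
    T-sym i j = +-cong (*-congˡ (δ-sym i j)) (*-congˡ (B-sym i j))

    T-action : ∀ x i → (T *ᵥ x) i ≈ lincomb ρ x (- 1#) (B *ᵥ x) i
    T-action x i = trans (·-lincombˡ ρ (δ i) (- 1#) (B i) x)
      (+-congʳ (*-congˡ (δ-identity x i)))

    form-T : ∀ x → form T x ≈ ρ * x · x - form B x
    form-T x = trans (·-congˡ x (T-action x)) (trans (·-lincombʳ x ρ x (- 1#) (B *ᵥ x))
      (solve 2 (λ n f → n :+ (:- con (+ 1)) :* f := n :- f) refl (ρ * x · x) (form B x)))

    0≤form-T : ∀ x → 0# ≤ form T x
    0≤form-T x = ≤-respʳ-≈ (sym (form-T x)) (x≤y⇒0≤y-x (form≤ρ x))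

    eigen : Coercive T ⊎ (∃[ x ] Nonzero x × form T x ≤ 0#) → ∃[ x ] Nonzero x × Eigenvector B ρ x
    eigen (inj₂ (x , x≉0 , T≤0)) = x , x≉0 , λ i → begin
      (B *ᵥ x) i
        ≈⟨ +-identityʳ _ ⟨
      (B *ᵥ x) i + 0#
        ≈⟨ +-congˡ (semidefinite-kernel T T-sym 0≤form-T x T≤0 i) ⟨
      (B *ᵥ x) i + (T *ᵥ x) i
        ≈⟨ +-congˡ (T-action x i) ⟩
      (B *ᵥ x) i + (ρ * x i + (- 1#) * (B *ᵥ x) i)
        ≈⟨ solve 2 (λ b r → b :+ (r :+ (:- con (+ 1)) :* b) := r) refl ((B *ᵥ x) i) (ρ * x i) ⟩
      ρ * x i  ∎
    eigen (inj₁ (K , 0<K , x·x≤KT)) with inverse K (0<⇒≉0 0<K)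
    ... | i , Ki≈1 = contradiction (least (ρ - i) improved) (<⇒≱ ρ-i<ρ)
      where
      ρ-i<ρ : ρ - i < ρ
      ρ-i<ρ = <-respʳ (solve 2 (λ r i → r :- i :+ i := r) refl ρ i)
        (≤∧≉⇒< (≤-by-difference (<⇒≤ 0<i) (solve 2 (λ r i → i := r :- i :+ i :- (r :- i)) refl ρ i))
          (λ eq → <⇒≉ 0<i (begin
            0#                     ≈⟨ -‿inverseʳ (ρ - i) ⟨
            ρ - i - (ρ - i)        ≈⟨ +-congʳ eq ⟩
            ρ - i + i - (ρ - i)    ≈⟨ solve 2 (λ r i → r :- i :+ i :- (r :- i) := i) refl ρ i ⟩
            i                      ∎)))
        where
        0<i : 0# < i
        0<i = 0<-inverse 0<K Ki≈1

      -- With `i` the inverse of `K`, coercivity of `T` says that the form of `B` is at most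
      -- `(ρ - i) * x · x`.
      improved : UpperBound (Quotient B) (ρ - i)
      improved s (x , x≉0 , le) = cancel-norm x x≉0 (≤-trans le (*-cancelˡ-≤ 0<K
        (≤-by-difference (x≤y⇒0≤y-x (x·x≤KT x)) (begin
          K * form T x - x · x
            ≈⟨ +-cong (*-congˡ (form-T x)) (-‿cong (trans (sym (*-identityˡ _)) (*-congʳ (sym Ki≈1)))) ⟩
          K * (ρ * x · x - form B x) - K * i * x · x
            ≈⟨ solve 5 (λ K r n f i → K :* (r :* n :- f) :- K :* i :* n := K :* ((r :- i) :* n) :- K :* f)
                 refl K ρ (x · x) (form B x) i ⟩
          K * ((ρ - i) * x · x) - K * form B x  ∎))))

  -- Completeness of the field supplies the supremum `ρ`, which is attained because `ρ I - B` cannot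
  -- be coercive. The given nonzero vector makes the set of quotients inhabited.
  max-rayleigh : (B : Matrix n) → Symmetric B → ∃ (Nonzero {n}) →
                 ∃[ ρ ] (∃[ x ] Nonzero x × Eigenvector B ρ x) × (∀ x → form B x ≤ ρ * x · x)
  max-rayleigh B B-sym (w , w≉0) =
    let s , s|w|²≈Bw      = rayleigh-quotient B w w≉0
        c , form≤c        = form-bounded B
        ρ , upper , least = supremum (Quotient B) (s , w , w≉0 , ≤-reflexive s|w|²≈Bw)
          (c , λ s (x , x≉0 , le) → cancel-norm x x≉0 (≤-trans le (form≤c x)))
        open Supremum B B-sym ρ upper least
    in ρ , eigen (coercive-or-nonpositive T T-sym) , form≤ρ

-- Subsets of vertices.

element-∈ : (S : Subset n) (i : Fin ∣ S ∣) → element S i ∈ S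
element-∈ (inside  ∷ S) zero    = here
element-∈ (inside  ∷ S) (suc i) = there (element-∈ S i)
element-∈ (outside ∷ S) i       = there (element-∈ S i)

element-surjective : (S : Subset n) {j : Fin n} → j ∈ S → ∃[ i ] element S i ≡ j
element-surjective (inside  ∷ S) here        = zero , ≡.refl
element-surjective (inside  ∷ S) (there j∈S) =
  let i , eq = element-surjective S j∈S in suc i , ≡.cong suc eq
element-surjective (outside ∷ S) (there j∈S) =
  let i , eq = element-surjective S j∈S in i , ≡.cong suc eq

-- Excluded middle decides `P`, so that the support of a vector becomes a `Subset`.
comprehension : ExcludedMiddle 0ℓ → (P : Fin n → Set) →
                ∃[ S ] (∀ {i} → i ∈ S → P i) × (∀ {i} → P i → i ∈ S)
comprehension em P = S , sound , complete
  where
  S = tabulate (λ i → does (em {P i}))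
  sound : ∀ {i} → i ∈ S → P i
  sound {i} i∈S with em {P i} | ≡.trans (≡.sym (lookup∘tabulate (λ i → does (em {P i})) i)) ([]=⇒lookup i∈S)
  ... | yes p | _ = p
  complete : ∀ {i} → P i → i ∈ S
  complete {i} p = lookup⇒[]= i S (≡.trans (lookup∘tabulate _ i) (dec-true em p))

-- Induced subgraphs and Rayleigh quotients above 2.

module Graphs (em : ExcludedMiddle 0ℓ) (ℝ : CompleteOrderedField) where

  open Rayleigh em ℝ public

  adjacency-sym : (G : Graph n) → Symmetric (adjacencyMatrix G)
  adjacency-sym G i j = reflexive (≡.cong (if_then 1# else 0#) (symmetric G i j))

  0≤adjacency : ∀ (G : Graph n) i j → 0# ≤ adjacencyMatrix G i j
  0≤adjacency G i j with adjacent G i j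
  ... | true  = <⇒≤ 0<1
  ... | false = ≤-reflexive refl

  graphForm : Graph n → Vector Carrier n → Carrier
  graphForm G = form (adjacencyMatrix G)

  -- Restriction to and extension from an induced subgraph

  Supported : Subset n → Vector Carrier n → Set
  Supported S x = ∀ i → i ∉ S → x i ≈ 0#

  ∑-element : ∀ (S : Subset n) f → Supported S f → ∑[ i < ∣ S ∣ ] f (element S i) ≈ ∑[ i < n ] f i
  ∑-element []            f f≈0 = refl
  ∑-element (inside  ∷ S) f f≈0 =
    +-congˡ (∑-element S (tail f) (λ i i∉S → f≈0 (suc i) (i∉S ∘ drop-there)))
  ∑-element (outside ∷ S) f f≈0 = begin
    ∑[ i < ∣ S ∣ ] f (suc (element S i))
      ≈⟨ ∑-element S (tail f) (λ i i∉S → f≈0 (suc i) (i∉S ∘ drop-there)) ⟩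
    ∑[ i < _ ] f (suc i)
      ≈⟨ +-identityˡ _ ⟨
    0# + ∑[ i < _ ] f (suc i)
      ≈⟨ +-congʳ (f≈0 zero λ ()) ⟨
    f zero + ∑[ i < _ ] f (suc i)  ∎

  -- The support condition is on `y` alone because `x` will be a row of the adjacency matrix or a
  -- product `A x`, which may spread beyond `S`.
  ·-element : ∀ (S : Subset n) x y → Supported S y → (x ∘ element S) · (y ∘ element S) ≈ x · y
  ·-element S x y y≈0 = ∑-element S _ (λ i i∉S → trans (*-congˡ (y≈0 i i∉S)) (zeroʳ (x i)))

  graphForm-restrict : ∀ (G : Graph n) S x → Supported S x → graphForm (G [ S ]) (x ∘ element S) ≈ graphForm G x
  graphForm-restrict G S x x≈0 = begin
    (x ∘ element S) · (adjacencyMatrix (G [ S ]) *ᵥ (x ∘ element S))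
      ≈⟨ ·-congˡ (x ∘ element S) (λ i → ·-element S (adjacencyMatrix G (element S i)) x x≈0) ⟩
    (x ∘ element S) · (Ax ∘ element S)
      ≈⟨ ·-comm (x ∘ element S) (Ax ∘ element S) ⟩
    (Ax ∘ element S) · (x ∘ element S)
      ≈⟨ ·-element S Ax x x≈0 ⟩
    Ax · x
      ≈⟨ ·-comm Ax x ⟩
    x · Ax  ∎
    where Ax = adjacencyMatrix G *ᵥ x

  extend : (S : Subset n) → Vector Carrier ∣ S ∣ → Vector Carrier n
  extend (inside  ∷ S) x zero    = x zero
  extend (inside  ∷ S) x (suc i) = extend S (tail x) i
  extend (outside ∷ S) x zero    = 0#
  extend (outside ∷ S) x (suc i) = extend S x i

  extend-element : ∀ (S : Subset n) x i → extend S x (element S i) ≡ x i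
  extend-element (inside  ∷ S) x zero    = ≡.refl
  extend-element (inside  ∷ S) x (suc i) = extend-element S (tail x) i
  extend-element (outside ∷ S) x i       = extend-element S x i

  extend-supported : ∀ (S : Subset n) x → Supported S (extend S x)
  extend-supported (inside  ∷ S) x zero    z∉S = contradiction here z∉S
  extend-supported (inside  ∷ S) x (suc i) i∉S = extend-supported S (tail x) i (i∉S ∘ there)
  extend-supported (outside ∷ S) x zero    _   = refl
  extend-supported (outside ∷ S) x (suc i) i∉S = extend-supported S x i (i∉S ∘ there)

  -- The good vectors of the overview: Rayleigh quotient above 2 with the norm multiplied out.
  -- Strictness excludes the zero vector.
  Above2 : Graph n → Vector Carrier n → Set
  Above2 G x = 2# * x · x < graphForm G x

  above2-restrict : ∀ (G : Graph n) S {x} → Supported S x → Above2 G x → Above2 (G [ S ]) (x ∘ element S)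
  above2-restrict G S {x} x≈0 above =
    <-respˡ (*-congˡ (sym (·-element S x x x≈0))) (<-respʳ (sym (graphForm-restrict G S x x≈0)) above)

  above2-extend : ∀ (G : Graph n) S {x} → Above2 (G [ S ]) x → Above2 G (extend S x)
  above2-extend G S {x} above =
    <-respˡ (*-congˡ (trans (·-cong (λ i → sym (ex i)) (λ i → sym (ex i))) (·-element S x′ x′ supp)))
      (<-respʳ (trans (form-cong (adjacencyMatrix (G [ S ])) (λ i → sym (ex i))) (graphForm-restrict G S x′ supp)) above)
    where
    x′ = extend S x
    supp = extend-supported S x
    ex : ∀ i → x′ (element S i) ≈ x i
    ex i = reflexive (extend-element S x i)

  above2-nonzero : ∀ (G : Graph n) {x} → Above2 G x → Nonzero x
  above2-nonzero G {x} (_ , 2x·x≉Ax) x≈0 = 2x·x≉Ax (begin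
    2# * x · x  ≈⟨ *-congˡ (·-zeroʳ x x x≈0) ⟩
    2# * 0#     ≈⟨ zeroʳ 2# ⟩
    0#          ≈⟨ ·-zeroʳ Ax x x≈0 ⟨
    Ax · x      ≈⟨ ·-comm Ax x ⟩
    graphForm G x       ∎)
    where Ax = adjacencyMatrix G *ᵥ x

  eigenvector-above2 : ∀ (G : Graph n) {μ x} → 2# < μ → Nonzero x → InEigenspace G μ x → Above2 G x
  eigenvector-above2 G {μ} {x} 2<μ x≉0 Ax≈μx =
    <-respʳ (sym (eigenvector-form (adjacencyMatrix G) Ax≈μx))
      (<-respˡ (*-comm _ _) (<-respʳ (*-comm _ _) (*-monoˡ-< (Nonzero⇒0<x·x x x≉0) 2<μ)))

  -- The maximal Rayleigh quotient is an eigenvalue and bounds all others. The bound on arbitrary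
  -- vectors is kept, since good vectors need not be eigenvectors.
  index-exists : (G : Graph n) → ∃ (Nonzero {n}) → ∃[ ρ ] IsIndex G ρ × (∀ x → graphForm G x ≤ ρ * x · x)
  index-exists G w =
    let ρ , eigen , q≤ρ = max-rayleigh (adjacencyMatrix G) (adjacency-sym G) w
    in ρ , (eigen , λ μ (x , x≉0 , Ax≈μx) → cancel-norm x x≉0
              (≤-respˡ-≈ (eigenvector-form (adjacencyMatrix G) Ax≈μx) (q≤ρ x))) , q≤ρ

  above2-index : (G : Graph n) {x : Vector Carrier n} → Above2 G x → IndexAbove2 G
  above2-index G {x} above =
    let ρ , isIndex , q≤ρ = index-exists G (x , above2-nonzero G above)
    in ρ , isIndex , ≰⇒> (λ ρ≤2 → <⇒≱ above (≤-trans (q≤ρ x)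
         (≤-respˡ-≈ (*-comm _ _) (≤-respʳ-≈ (*-comm _ _) (*-monoˡ-≤ (0≤x·x x) ρ≤2)))))

  above2-noncyclotomic : (G : Graph n) {x : Vector Carrier n} → Above2 G x → ¬ Cyclotomic G
  above2-noncyclotomic G above cyclotomic =
    let ρ , (eigen , _) , 2<ρ = above2-index G above
    in <⇒≱ 2<ρ (proj₂ (cyclotomic ρ eigen))

  -- Minimal induced subgraphs

  -- On a single vertex the form is zero by looplessness, and no vector is good.
  above2-second-vertex : ∀ (G : Graph n) v {x} → Above2 G x → ∃[ j ] j ≢ v
  above2-second-vertex G v {x} above with em {∃[ j ] j ≢ v}
  ... | yes other = other
  ... | no  none  = contradiction (≤-respˡ-≈ (sym q≈0) (*-nonNeg (<⇒≤ 0<2) (0≤x·x x))) (<⇒≱ above)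
    where
    all-v : ∀ j → j ≡ v
    all-v j with j ≟ v
    ... | yes j≡v = j≡v
    ... | no  j≢v = contradiction (j , j≢v) none
    Aij≈0 : ∀ i j → adjacencyMatrix G i j ≈ 0#
    Aij≈0 i j = reflexive (≡.cong (if_then 1# else 0#)
      (≡.trans (≡.cong (adjacent G i) (≡.trans (all-v j) (≡.sym (all-v i)))) (loopless G i)))
    q≈0 : graphForm G x ≈ 0#
    q≈0 = ·-zeroʳ x _ (λ i → ∑-zero _ (λ j → trans (*-congʳ (Aij≈0 i j)) (zeroˡ (x j))))

  -- `IndexAtMost2` demands that the vertex-deleted graph have an index, hence a vertex.
  delete-nonempty : ∀ (G : Graph n) v {x} → Above2 G x → ∃ (Nonzero {∣ ∁ ⁅ v ⁆ ∣})
  delete-nonempty G v above =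
    let j , j≢v = above2-second-vertex G v above
        i , _   = element-surjective (∁ ⁅ v ⁆) (x∉p⇒x∈∁p (x≢y⇒x∉⁅y⁆ j≢v))
    in (λ _ → 1#) , λ 1≈0 → 0≉1 (sym (1≈0 i))

  Above2On : Graph n → Subset n → Set
  Above2On G S = ∃[ x ] Supported S x × Above2 G x

  -- An eigenvector for an eigenvalue above 2 after one more deletion, extended by zero twice, would
  -- be a good vector on `S` without that vertex.
  critical-minimal : ∀ (G : Graph n) S → Above2On G S →
                     ¬ (∃[ i ] i ∈ S × Above2On G (S ∖ i)) → Minimal (G [ S ])
  critical-minimal G S (x , supp , above) critical =
    above2-index (G [ S ]) aboveS , λ v →
      let ρ , (eigen , max) , _ = index-exists (deleteVertex (G [ S ]) v) (delete-nonempty (G [ S ]) v aboveS)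
      in ρ , (eigen , max) , ρ≤2 v eigen
    where
    aboveS = above2-restrict G S supp above

    supported : ∀ v y → Supported (S ∖ element S v) (extend S (extend (∁ ⁅ v ⁆) y))
    supported v y i i∉ with i ∈? S | i ≟ element S v
    ... | no i∉S  | _          = extend-supported S _ i i∉S
    ... | yes i∈S | no i≢v     = contradiction (x∈p∧x≢y⇒x∈p-y i∈S i≢v) i∉
    -- At the deleted vertex the outer extension copies the inner one, which is zero there.
    ... | yes _   | yes ≡.refl = trans (reflexive (extend-element S _ v))
      (extend-supported (∁ ⁅ v ⁆) y v (x∈p⇒x∉∁p (x∈⁅x⁆ v)))

    ρ≤2 : ∀ v {ρ} → Eigenvalue (deleteVertex (G [ S ]) v) ρ → ρ ≤ 2#
    ρ≤2 v {ρ} (y , y≉0 , Ay≈ρy) with ≤-or-> ρ 2#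
    ... | inj₁ ρ≤2 = ρ≤2
    ... | inj₂ 2<ρ = contradiction
      (element S v , element-∈ S v , _ , supported v y ,
       above2-extend G S (above2-extend (G [ S ]) (∁ ⁅ v ⁆)
         (eigenvector-above2 (deleteVertex (G [ S ]) v) 2<ρ y≉0 Ay≈ρy)))
      critical

  -- Vertices are deleted while some good vector survives; strict inclusion is well-founded, and the
  -- set at which this stops is critical.
  minimal-subgraph : ∀ (G : Graph n) S → Above2On G S → ∃[ M ] M ⊆ S × Minimal (G [ M ])
  minimal-subgraph {n} G S = go S (⊂-wellFounded S)
    where
    go : ∀ S → Acc _⊂_ S → Above2On G S → ∃[ M ] M ⊆ S × Minimal (G [ M ])
    go S (acc rec) above with em {∃[ i ] i ∈ S × Above2On G (S ∖ i)}
    ... | no  critical             = S , id , critical-minimal G S above critical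
    ... | yes (i , i∈S , above-i) =
      let M , M⊆S∖i , minimal = go (S ∖ i) (rec (x∈p⇒p-x⊂p i∈S)) above-i
      in M , p─q⊆p S ⁅ i ⁆ ∘ M⊆S∖i , minimal

-- From orthogonal eigenvectors to the Salem property.

module SalemGraphs (em : ExcludedMiddle 0ℓ) (ℝ : CompleteOrderedField) where

  open Graphs em ℝ

  eigenspace-resp : ∀ (G : Graph n) {μ ν x} → μ ≈ ν → InEigenspace G μ x → InEigenspace G ν x
  eigenspace-resp G μ≈ν Ax≈μx i = trans (Ax≈μx i) (*-congʳ μ≈ν)

  eigenspace-lincomb : ∀ (G : Graph n) {μ x y} a b → InEigenspace G μ x → InEigenspace G μ y →
                       InEigenspace G μ (lincomb a x b y)
  eigenspace-lincomb G {μ} {x} {y} a b Ax≈μx Ay≈μy i = begin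
    (adjacencyMatrix G *ᵥ lincomb a x b y) i
      ≈⟨ *ᵥ-lincomb (adjacencyMatrix G) a x b y i ⟩
    a * (adjacencyMatrix G *ᵥ x) i + b * (adjacencyMatrix G *ᵥ y) i
      ≈⟨ +-cong (*-congˡ (Ax≈μx i)) (*-congˡ (Ay≈μy i)) ⟩
    a * (μ * x i) + b * (μ * y i)
      ≈⟨ solve 5 (λ a b m x y → a :* (m :* x) :+ b :* (m :* y) := m :* (a :* x :+ b :* y))
           refl a b μ (x i) (y i) ⟩
    μ * lincomb a x b y i  ∎

  -- Self-adjointness evaluates `x · A y` in two ways, whose difference is `(μ - ν) * x · y`.
  eigenvectors-orthogonal : ∀ (G : Graph n) {μ ν x y} → ¬ (μ ≈ ν) →
    InEigenspace G μ x → InEigenspace G ν y → x · y ≈ 0#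
  eigenvectors-orthogonal G {μ} {ν} {x} {y} μ≉ν Ax≈μx Ay≈νy = *-cancelˡ-0 μ-ν≉0 (begin
    (μ - ν) * x · y
      ≈⟨ solve 3 (λ m v t → (m :- v) :* t := m :* t :- v :* t) refl μ ν (x · y) ⟩
    μ * x · y - ν * x · y
      ≈⟨ +-cong (*-congˡ (·-comm x y)) (-‿cong (sym (·-scaleʳ x ν y))) ⟩
    μ * y · x - x · (λ i → ν * y i)
      ≈⟨ +-cong (sym (·-scaleʳ y μ x)) (-‿cong (·-congˡ x (λ i → sym (Ay≈νy i)))) ⟩
    y · (λ i → μ * x i) - x · (A *ᵥ y)
      ≈⟨ +-cong (·-congˡ y (λ i → sym (Ax≈μx i))) (-‿cong (self-adjoint A (adjacency-sym G) x y)) ⟩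
    y · (A *ᵥ x) - y · (A *ᵥ x)
      ≈⟨ -‿inverseʳ _ ⟩
    0#  ∎)
    where
    A = adjacencyMatrix G
    μ-ν≉0 : ¬ (μ - ν ≈ 0#)
    μ-ν≉0 μ-ν≈0 = μ≉ν (begin
      μ           ≈⟨ solve 2 (λ m v → m := m :- v :+ v) refl μ ν ⟩
      μ - ν + ν   ≈⟨ +-congʳ μ-ν≈0 ⟩
      0# + ν      ≈⟨ +-identityˡ ν ⟩
      ν           ∎)

  -- Reflection of the spectrum of a bipartite graph.

  module SignChange (G : Graph n) (bipartite : Bipartite G) where

    ε : Vector Carrier n
    ε i = if proj₁ bipartite i then 1# else - 1#

    signed : Vector Carrier n → Vector Carrier n
    signed x i = ε i * x i

    ε-involutive : ∀ i a → ε i * (ε i * a) ≈ a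
    ε-involutive i a with proj₁ bipartite i
    ... | true  = trans (*-identityˡ _) (*-identityˡ a)
    ... | false = solve 1 (λ a → :- con (+ 1) :* (:- con (+ 1) :* a) := a) refl a

    -- Every edge joins opposite signs, so the diagonal matrix of signs anticommutes with the
    -- adjacency matrix.
    adjacency-ε : ∀ i j → adjacencyMatrix G i j * ε j ≈ - ε i * adjacencyMatrix G i j
    adjacency-ε i j with adjacent G i j | proj₂ bipartite i j
    ... | false | _ = trans (zeroˡ _) (sym (zeroʳ _))
    ... | true  | ci≢cj with proj₁ bipartite i | proj₁ bipartite j
    ...   | true  | true  = contradiction ≡.refl (ci≢cj ≡.refl)
    ...   | true  | false = solve 0 (con (+ 1) :* :- con (+ 1) := :- con (+ 1) :* con (+ 1)) refl
    ...   | false | true  = solve 0 (con (+ 1) :* con (+ 1) := :- :- con (+ 1) :* con (+ 1)) refl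
    ...   | false | false = contradiction ≡.refl (ci≢cj ≡.refl)

    signed-eigenspace : ∀ {μ x} → InEigenspace G μ x → InEigenspace G (- μ) (signed x)
    signed-eigenspace {μ} {x} Ax≈μx i = begin
      A i · signed x
        ≈⟨ sum-cong-≋ (λ j → trans (sym (*-assoc (A i j) (ε j) (x j)))
             (trans (*-congʳ (adjacency-ε i j)) (*-assoc (- ε i) (A i j) (x j)))) ⟩
      ∑[ j < n ] (- ε i * (A i j * x j))
        ≈⟨ *-distribˡ-sum (- ε i) (λ j → A i j * x j) ⟨
      - ε i * A i · x
        ≈⟨ *-congˡ (Ax≈μx i) ⟩
      - ε i * (μ * x i)
        ≈⟨ solve 3 (λ e m x → :- e :* (m :* x) := :- m :* (e :* x)) refl (ε i) μ (x i) ⟩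
      - μ * signed x i  ∎
      where A = adjacencyMatrix G

    signed-nonzero : ∀ {x} → Nonzero x → Nonzero (signed x)
    signed-nonzero x≉0 εx≈0 = x≉0 (λ i →
      trans (sym (ε-involutive i _)) (trans (*-congˡ (εx≈0 i)) (zeroʳ (ε i))))

    eigenvalue-neg : ∀ {μ} → Eigenvalue G μ → Eigenvalue G (- μ)
    eigenvalue-neg (x , x≉0 , Ax≈μx) = signed x , signed-nonzero x≉0 , signed-eigenspace Ax≈μx

    -- The sign change is a linear involution exchanging the eigenspaces of `μ` and `- μ`, so a
    -- spanning vector is carried along.
    simple-neg : ∀ {μ} → SimpleEigenvalue G μ → SimpleEigenvalue G (- μ)
    simple-neg {μ} (x , x≉0 , Ax≈μx , span) =
      signed x , signed-nonzero x≉0 , signed-eigenspace Ax≈μx , λ y Ay≈-μy →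
        let c , εy≈cx = span (signed y)
              (eigenspace-resp G (-‿involutive μ) (signed-eigenspace Ay≈-μy))
        in c , λ i → begin
          y i                ≈⟨ ε-involutive i (y i) ⟨
          ε i * signed y i   ≈⟨ *-congˡ (εy≈cx i) ⟩
          ε i * (c * x i)    ≈⟨ solve 3 (λ e c x → e :* (c :* x) := c :* (e :* x)) refl (ε i) c (x i) ⟩
          c * signed x i     ∎

    -- An eigenvalue below `- 2#` would reflect to one above `2#`; if the latter kind is absent, the
    -- whole spectrum lies in the interval.
    eigenvalue-above2 : ¬ Cyclotomic G → ∃[ ρ ] 2# < ρ × Eigenvalue G ρ
    eigenvalue-above2 noncyclotomic with em {∃[ ρ ] 2# < ρ × Eigenvalue G ρ}
    ... | yes above = above
    ... | no  none  = contradiction cyclotomic noncyclotomic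
      where
      ≤2 : ∀ μ → Eigenvalue G μ → μ ≤ 2#
      ≤2 μ eigen with ≤-or-> μ 2#
      ... | inj₁ μ≤2 = μ≤2
      ... | inj₂ 2<μ = contradiction (μ , 2<μ , eigen) none
      cyclotomic : Cyclotomic G
      cyclotomic μ eigen =
        ≤-respʳ-≈ (-‿involutive μ) (-‿anti-≤ (≤2 (- μ) (eigenvalue-neg eigen))) , ≤2 μ eigen

  -- The values `μ` and `ν` may coincide, so this covers a multiple eigenvalue as well as two
  -- distinct ones.
  OrthogonalPair : Graph n → Set
  OrthogonalPair G =
    ∃[ μ ] ∃[ ν ] ∃[ x ] ∃[ y ] (2# < μ × Nonzero x × InEigenspace G μ x) ×
                                (2# < ν × Nonzero y × InEigenspace G ν y) × x · y ≈ 0#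

  -- The component of `y` orthogonal to `x`, scaled by `x · x`, stays in the eigenspace. Were it
  -- nonzero, it would form an orthogonal pair with `x`.
  simple-above2 : ∀ (G : Graph n) {μ} → ¬ OrthogonalPair G → 2# < μ → Eigenvalue G μ →
                  SimpleEigenvalue G μ
  simple-above2 G {μ} none 2<μ (x , x≉0 , Ax≈μx) = x , x≉0 , Ax≈μx , span
    where
    span : ∀ y → InEigenspace G μ y → ∃[ c ] (∀ i → y i ≈ c * x i)
    span y Ay≈μy with em {Nonzero (lincomb (x · x) y (- x · y) x)}
    ... | yes u≉0 = contradiction
      (μ , μ , x , lincomb (x · x) y (- x · y) x , (2<μ , x≉0 , Ax≈μx) ,
       (2<μ , u≉0 , eigenspace-lincomb G (x · x) (- x · y) Ay≈μy Ax≈μx) ,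
       trans (·-lincombʳ x (x · x) y (- x · y) x)
         (solve 2 (λ xx xy → xx :* xy :+ :- xy :* xx := con (+ 0)) refl (x · x) (x · y)))
      none
    ... | no ¬u≉0 =
      let k , xxk≈1 = inverse (x · x) (0<⇒≉0 (Nonzero⇒0<x·x x x≉0))
      -- The projection coefficient of `y` on `x`, with `k` the inverse of `x · x`.
      in k * x · y , λ i → begin
        y i
          ≈⟨ *-identityˡ (y i) ⟨
        1# * y i
          ≈⟨ *-congʳ xxk≈1 ⟨
        x · x * k * y i
          ≈⟨ solve 5 (λ xx k y xy x → xx :* k :* y := k :* (xx :* y :+ :- xy :* x) :+ k :* xy :* x)
               refl (x · x) k (y i) (x · y) (x i) ⟩
        k * lincomb (x · x) y (- x · y) x i + k * x · y * x i
          ≈⟨ +-congʳ (trans (*-congˡ (u≈0 i)) (zeroʳ k)) ⟩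
        0# + k * x · y * x i
          ≈⟨ +-identityˡ _ ⟩
        k * x · y * x i  ∎
      where
      u≈0 : ∀ i → lincomb (x · x) y (- x · y) x i ≈ 0#
      u≈0 with em {∀ i → lincomb (x · x) y (- x · y) x i ≈ 0#}
      ... | yes u≈0 = u≈0
      ... | no  u≉0 = contradiction u≉0 ¬u≉0

  -- Without an orthogonal pair, an eigenvalue above 2 is simple and unique; the reflection gives
  -- the same for its negative.
  salem-criterion : (G : Graph n) → ¬ Cyclotomic G → Bipartite G → ¬ OrthogonalPair G → Salem G
  salem-criterion G noncyclotomic bipartite none =
    let ρ , 2<ρ , eigen = eigenvalue-above2 noncyclotomic
        simple = simple-above2 G none 2<ρ eigen
    in bipartite , ρ , 2<ρ , simple , simple-neg simple , unique 2<ρ eigen ,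
       λ μ eigenμ μ<-2 → trans (sym (-‿involutive μ)) (-‿cong
         (unique 2<ρ eigen (- μ) (eigenvalue-neg eigenμ) (<-respˡ (-‿involutive 2#) (-‿anti-< μ<-2))))
    where
    open SignChange G bipartite
    unique : ∀ {ρ} → 2# < ρ → Eigenvalue G ρ → ∀ μ → Eigenvalue G μ → 2# < μ → μ ≈ ρ
    unique {ρ} 2<ρ (x , x≉0 , Ax≈ρx) μ (y , y≉0 , Ay≈μy) 2<μ with em {μ ≈ ρ}
    ... | yes μ≈ρ = μ≈ρ
    ... | no  μ≉ρ = contradiction
      (μ , ρ , y , x , (2<μ , y≉0 , Ay≈μy) , (2<ρ , x≉0 , Ax≈ρx) ,
       eigenvectors-orthogonal G μ≉ρ Ay≈μy Ax≈ρx)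
      none

  -- Deleting one vertex

  0<-*² : ∀ {a c} → ¬ (a ≈ 0#) → 0# < c → 0# < a * (a * c)
  0<-*² {a} {c} a≉0 0<c = <-respʳ (*-assoc a a c)
    (0<-* (0≤x² a , λ 0≈a² → a≉0 (x²≈0⇒x≈0 (sym 0≈a²))) 0<c)

  -- Orthogonality removes the mixed terms from both the norm and the form, since
  -- `y · A x = μ * y · x`. The excess over 2 is then additive, and `a` being nonzero makes it
  -- strictly positive.
  above2-lincomb : ∀ (G : Graph n) {μ ν x y} a b →
    (2# < μ × Nonzero x × InEigenspace G μ x) → (2# < ν × Nonzero y × InEigenspace G ν y) →
    x · y ≈ 0# → ¬ (a ≈ 0#) → Above2 G (lincomb a x b y)
  above2-lincomb G {μ} {ν} {x} {y} a b (2<μ , x≉0 , Ax≈μx) (2<ν , y≉0 , Ay≈νy) x·y≈0 a≉0 =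
    ≤-by-difference (<⇒≤ 0<d) (sym d≈) , λ eq → <⇒≉ 0<d (begin
      0#                                   ≈⟨ -‿inverseʳ _ ⟨
      graphForm G z - graphForm G z                        ≈⟨ +-congˡ (-‿cong eq) ⟨
      graphForm G z - 2# * z · z                   ≈⟨ d≈ ⟩
      d                                    ∎)
    where
    z = lincomb a x b y
    d = a * (a * (graphForm G x - 2# * x · x)) + b * (b * (graphForm G y - 2# * y · y))

    y·Ax≈0 : y · (adjacencyMatrix G *ᵥ x) ≈ 0#
    y·Ax≈0 = begin
      y · (adjacencyMatrix G *ᵥ x)   ≈⟨ ·-congˡ y Ax≈μx ⟩
      y · (λ i → μ * x i)            ≈⟨ ·-scaleʳ y μ x ⟩
      μ * y · x                      ≈⟨ *-congˡ (trans (·-comm y x) x·y≈0) ⟩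
      μ * 0#                         ≈⟨ zeroʳ μ ⟩
      0#                             ∎

    0<d : 0# < d
    0<d = 0<-+ (0<-*² a≉0 (x<y⇒0<y-x (eigenvector-above2 G 2<μ x≉0 Ax≈μx)))
      (≤-respʳ-≈ (*-assoc b b _)
        (*-nonNeg (0≤x² b) (x≤y⇒0≤y-x (<⇒≤ (eigenvector-above2 G 2<ν y≉0 Ay≈νy)))))

    d≈ : graphForm G z - 2# * z · z ≈ d
    d≈ = begin
      graphForm G z - 2# * z · z
        ≈⟨ +-cong
             (trans (form-lincomb (adjacencyMatrix G) (adjacency-sym G) a x b y)
               (+-congʳ (+-congˡ (+-cong (*-congˡ (*-congˡ y·Ax≈0)) (*-congˡ (*-congˡ y·Ax≈0))))))
             (-‿cong (*-congˡ (trans (lincomb-norm a x b y)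
               (+-congʳ (+-congˡ (+-cong (*-congˡ (*-congˡ x·y≈0)) (*-congˡ (*-congˡ x·y≈0)))))))) ⟩
      _ ≈⟨ solve 6 (λ a b qx qy xx yy → let o = con (+ 0) ; two = con (+ 1) :+ con (+ 1) in
             a :* (a :* qx) :+ (a :* (b :* o) :+ a :* (b :* o)) :+ b :* (b :* qy)
               :- two :* (a :* (a :* xx) :+ (a :* (b :* o) :+ a :* (b :* o)) :+ b :* (b :* yy))
             := a :* (a :* (qx :- two :* xx)) :+ b :* (b :* (qy :- two :* yy)))
           refl a b (graphForm G x) (graphForm G y) (x · x) (y · y) ⟩
      d  ∎

  above2-vanishing : ∀ (G : Graph n) v → OrthogonalPair G → ∃[ z ] z v ≈ 0# × Above2 G z
  above2-vanishing G v (μ , ν , x , y , px@(2<μ , x≉0 , Ax≈μx) , py , x·y≈0) with em {y v ≈ 0#}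
  ... | yes yv≈0 = y , yv≈0 , (let 2<ν , y≉0 , Ay≈νy = py in eigenvector-above2 G 2<ν y≉0 Ay≈νy)
  -- These coefficients cancel the two entries at `v`, and the first is nonzero as `above2-lincomb`
  -- requires.
  ... | no  yv≉0 = lincomb (y v) x (- x v) y ,
    solve 2 (λ x y → y :* x :+ :- x :* y := con (+ 0)) refl (x v) (y v) ,
    above2-lincomb G (y v) (- x v) px py x·y≈0 yv≉0

  deletion-no-pair : ∀ (G : Graph n) v → Cyclotomic (deleteVertex G v) → ¬ OrthogonalPair G
  deletion-no-pair G v cyclotomic pair =
    let z , zv≈0 , above = above2-vanishing G v pair
    in above2-noncyclotomic (deleteVertex G v)
         (above2-restrict G (∁ ⁅ v ⁆)
           (λ i i∉ → trans (reflexive (≡.cong z (x∈⁅y⁆⇒x≡y v (x∉∁p⇒x∈p i∉)))) zv≈0) above)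
         cyclotomic

  -- Disjoint supports

  DisjointPair : Graph n → Set
  DisjointPair G = ∃[ x ] ∃[ y ] Above2 G x × Above2 G y × (∀ i → x i ≈ 0# ⊎ y i ≈ 0#)

  -- Where `total` could answer either way, `a` is zero and both answers give zero parts.
  posPart negPart : Carrier → Carrier
  posPart a = [ (λ _ → a) , (λ _ → 0#) ]′ (total 0# a)
  negPart a = [ (λ _ → 0#) , (λ _ → - a) ]′ (total 0# a)

  0≤posPart : ∀ a → 0# ≤ posPart a
  0≤posPart a with total 0# a
  ... | inj₁ 0≤a = 0≤a
  ... | inj₂ _   = ≤-reflexive refl

  0≤negPart : ∀ a → 0# ≤ negPart a
  0≤negPart a with total 0# a
  ... | inj₁ _   = ≤-reflexive refl
  ... | inj₂ a≤0 = ≤-respˡ-≈ -0#≈0# (-‿anti-≤ a≤0)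

  posPart-negPart : ∀ a → posPart a ≈ 0# ⊎ negPart a ≈ 0#
  posPart-negPart a with total 0# a
  ... | inj₁ _ = inj₂ refl
  ... | inj₂ _ = inj₁ refl

  -- Stated like `negPart-split` in the shape of a `lincomb`, so that `part-above2` applies to the
  -- positive part of `x` and to the negative part as the positive part of `- x`.
  posPart-split : ∀ a → posPart a ≈ 1# * a + 1# * negPart a
  posPart-split a with total 0# a
  ... | inj₁ _ = solve 1 (λ a → a := con (+ 1) :* a :+ con (+ 1) :* con (+ 0)) refl a
  ... | inj₂ _ = solve 1 (λ a → con (+ 0) := con (+ 1) :* a :+ con (+ 1) :* :- a) refl a

  negPart-split : ∀ a → negPart a ≈ 1# * - a + 1# * posPart a
  negPart-split a with total 0# a
  ... | inj₁ _ = solve 1 (λ a → con (+ 0) := con (+ 1) :* :- a :+ con (+ 1) :* a) refl a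
  ... | inj₂ _ = solve 1 (λ a → :- a := con (+ 1) :* :- a :+ con (+ 1) :* con (+ 0)) refl a

  disjoint-· : (x y : Vector Carrier n) → (∀ i → x i ≈ 0# ⊎ y i ≈ 0#) → x · y ≈ 0#
  disjoint-· x y disjoint = ∑-zero _ (λ i →
    [ (λ xi≈0 → trans (*-congʳ xi≈0) (zeroˡ (y i))) , (λ yi≈0 → trans (*-congˡ yi≈0) (zeroʳ (x i))) ]′
      (disjoint i))

  -- With p and m the two parts of an eigenvector x = p - m, the cross term p · A m is nonnegative.
  part-above2 : ∀ (G : Graph n) {μ x} p m → 2# < μ → InEigenspace G μ x →
    (∀ i → 0# ≤ p i) → (∀ i → 0# ≤ m i) → (∀ i → p i ≈ 0# ⊎ m i ≈ 0#) →
    (∀ i → p i ≈ 1# * x i + 1# * m i) → Nonzero p → Above2 G p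
  part-above2 {n} G {μ} {x} p m 2<μ Ax≈μx 0≤p 0≤m disjoint p≈x+m p≉0 =
    <-≤-trans
      (<-respˡ (*-comm _ _) (<-respʳ (*-comm _ _) (*-monoˡ-< (Nonzero⇒0<x·x p p≉0) 2<μ)))
      (≤-by-difference 0≤p·Am (begin
        p · (A *ᵥ m)
          ≈⟨ solve 3 (λ m px r → r := con (+ 1) :* (m :* px) :+ con (+ 1) :* r :- m :* px) refl μ (p · x) (p · (A *ᵥ m)) ⟩
        1# * (μ * p · x) + 1# * p · (A *ᵥ m) - μ * p · x
          ≈⟨ +-cong (sym qp) (-‿cong (*-congˡ p·x≈p·p)) ⟩
        graphForm G p - μ * p · p  ∎))
    where
    A = adjacencyMatrix G

    p·x≈p·p : p · x ≈ p · p
    p·x≈p·p = begin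
      p · x
        ≈⟨ solve 1 (λ px → px := con (+ 1) :* px :+ con (+ 1) :* con (+ 0)) refl (p · x) ⟩
      1# * p · x + 1# * 0#
        ≈⟨ +-congˡ (*-congˡ (disjoint-· p m disjoint)) ⟨
      1# * p · x + 1# * p · m
        ≈⟨ ·-lincombʳ p 1# x 1# m ⟨
      p · lincomb 1# x 1# m
        ≈⟨ ·-congˡ p p≈x+m ⟨
      p · p  ∎

    qp : graphForm G p ≈ 1# * (μ * p · x) + 1# * p · (A *ᵥ m)
    qp = begin
      p · (A *ᵥ p)
        ≈⟨ ·-congˡ p (λ i → trans (*ᵥ-cong A p≈x+m i) (*ᵥ-lincomb A 1# x 1# m i)) ⟩
      p · lincomb 1# (A *ᵥ x) 1# (A *ᵥ m)
        ≈⟨ ·-lincombʳ p 1# (A *ᵥ x) 1# (A *ᵥ m) ⟩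
      1# * p · (A *ᵥ x) + 1# * p · (A *ᵥ m)
        ≈⟨ +-congʳ (*-congˡ (trans (·-congˡ p Ax≈μx) (·-scaleʳ p μ x))) ⟩
      1# * (μ * p · x) + 1# * p · (A *ᵥ m)  ∎

    0≤p·Am : 0# ≤ p · (A *ᵥ m)
    0≤p·Am = ∑-nonNeg _ (λ i → *-nonNeg (0≤p i)
      (∑-nonNeg _ (λ j → *-nonNeg (0≤adjacency G i j) (0≤m j))))

  -- Instances have `σ` equal to `1#` or `- 1#`; being a multiple of `x` is what carries
  -- orthogonality over to `a`.
  NonNegMultiple : Graph n → Vector Carrier n → Set
  NonNegMultiple G x = ∃[ a ] ∃[ σ ] Above2 G a × (∀ i → 0# ≤ a i) × (∀ i → a i ≈ σ * x i)

  -- If both parts of `x` are nonzero, they are good with disjoint supports. If one vanishes, the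
  -- other is `x` up to sign.
  mixed-or-one-signed : ∀ (G : Graph n) {μ x} → 2# < μ → Nonzero x → InEigenspace G μ x →
                        DisjointPair G ⊎ NonNegMultiple G x
  mixed-or-one-signed {n} G {μ} {x} 2<μ x≉0 Ax≈μx = cases em em
    where
    p m -x : Vector Carrier n
    p i  = posPart (x i)
    m i  = negPart (x i)
    -x i = - x i

    A-x≈μ-x : InEigenspace G μ -x
    A-x≈μ-x i = begin
      (adjacencyMatrix G *ᵥ -x) i
        ≈⟨ ·-congˡ (adjacencyMatrix G i)
             (λ j → solve 1 (λ a → :- a := :- con (+ 1) :* a) refl (x j)) ⟩
      (adjacencyMatrix G *ᵥ (λ j → - 1# * x j)) i
        ≈⟨ ·-scaleʳ (adjacencyMatrix G i) (- 1#) x ⟩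
      - 1# * (adjacencyMatrix G *ᵥ x) i
        ≈⟨ *-congˡ (Ax≈μx i) ⟩
      - 1# * (μ * x i)
        ≈⟨ solve 2 (λ m a → :- con (+ 1) :* (m :* a) := m :* :- a) refl μ (x i) ⟩
      μ * - x i  ∎

    p-above2 : Nonzero p → Above2 G p
    p-above2 = part-above2 G p m 2<μ Ax≈μx (λ i → 0≤posPart (x i)) (λ i → 0≤negPart (x i))
      (λ i → posPart-negPart (x i)) (λ i → posPart-split (x i))

    m-above2 : Nonzero m → Above2 G m
    m-above2 = part-above2 G m p 2<μ A-x≈μ-x (λ i → 0≤negPart (x i)) (λ i → 0≤posPart (x i))
      (λ i → swap (posPart-negPart (x i))) (λ i → negPart-split (x i))

    cases : Dec (∀ i → p i ≈ 0#) → Dec (∀ i → m i ≈ 0#) → DisjointPair G ⊎ NonNegMultiple G x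
    cases (no p≉0) (no m≉0) = inj₁ (p , m , p-above2 p≉0 , m-above2 m≉0 , λ i → posPart-negPart (x i))
    cases (no p≉0) (yes m≈0) = inj₂ (p , 1# , p-above2 p≉0 , (λ i → 0≤posPart (x i)) , λ i → begin
      p i                    ≈⟨ posPart-split (x i) ⟩
      1# * x i + 1# * m i    ≈⟨ +-congˡ (trans (*-congˡ (m≈0 i)) (zeroʳ 1#)) ⟩
      1# * x i + 0#          ≈⟨ +-identityʳ _ ⟩
      1# * x i               ∎)
    cases (yes p≈0) (no m≉0) = inj₂ (m , - 1# , m-above2 m≉0 , (λ i → 0≤negPart (x i)) , λ i → begin
      m i                      ≈⟨ negPart-split (x i) ⟩
      1# * - x i + 1# * p i    ≈⟨ +-congˡ (*-congˡ (p≈0 i)) ⟩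
      1# * - x i + 1# * 0#     ≈⟨ solve 1 (λ a → let i = con (+ 1) in i :* :- a :+ i :* con (+ 0) := :- i :* a) refl (x i) ⟩
      - 1# * x i               ∎)
    cases (yes p≈0) (yes m≈0) = contradiction (λ i → begin
      x i                            ≈⟨ solve 2 (λ a m → a := con (+ 1) :* a :+ con (+ 1) :* m :- m) refl (x i) (m i) ⟩
      1# * x i + 1# * m i - m i      ≈⟨ +-cong (sym (posPart-split (x i))) (-‿cong (m≈0 i)) ⟩
      p i - 0#                       ≈⟨ +-cong (p≈0 i) -0#≈0# ⟩
      0# + 0#                        ≈⟨ +-identityˡ 0# ⟩
      0#                             ∎) x≉0

  -- In the remaining case both vectors are nonnegative and orthogonal, so each summand of their
  -- inner product is zero.
  orthogonal⇒disjoint : (G : Graph n) → OrthogonalPair G → DisjointPair G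
  orthogonal⇒disjoint G (μ , ν , x , y , (2<μ , x≉0 , Ax≈μx) , (2<ν , y≉0 , Ay≈νy) , x·y≈0) =
    combine (mixed-or-one-signed G 2<μ x≉0 Ax≈μx) (mixed-or-one-signed G 2<ν y≉0 Ay≈νy)
    where
    combine : DisjointPair G ⊎ NonNegMultiple G x → DisjointPair G ⊎ NonNegMultiple G y → DisjointPair G
    combine (inj₁ pair) _           = pair
    combine (inj₂ _)    (inj₁ pair) = pair
    combine (inj₂ (a , σ , a-above2 , 0≤a , a≈σx)) (inj₂ (b , τ , b-above2 , 0≤b , b≈τy)) =
      a , b , a-above2 , b-above2 , disjoint
      where
      a·b≈0 : a · b ≈ 0#
      a·b≈0 = begin
        a · b
          ≈⟨ ·-cong a≈σx b≈τy ⟩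
        (λ i → σ * x i) · (λ i → τ * y i)
          ≈⟨ ·-scaleʳ (λ i → σ * x i) τ y ⟩
        τ * (λ i → σ * x i) · y
          ≈⟨ *-congˡ (trans (·-comm (λ i → σ * x i) y) (·-scaleʳ y σ x)) ⟩
        τ * (σ * y · x)
          ≈⟨ *-congˡ (trans (*-congˡ (trans (·-comm y x) x·y≈0)) (zeroʳ σ)) ⟩
        τ * 0#
          ≈⟨ zeroʳ τ ⟩
        0#  ∎

      disjoint : ∀ i → a i ≈ 0# ⊎ b i ≈ 0#
      disjoint i with em {a i ≈ 0#}
      ... | yes ai≈0 = inj₁ ai≈0
      ... | no  ai≉0 = inj₂ (*-cancelˡ-0 ai≉0
        (∑-nonNeg-zero _ (λ j → *-nonNeg (0≤a j) (0≤b j)) a·b≈0 i))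

  minimal-complements-no-pair : (G : Graph n) →
    (∀ S → Minimal (G [ S ]) → Cyclotomic (G [ ∁ S ])) → ¬ OrthogonalPair G
  minimal-complements-no-pair G complements pair =
    let x , y , x-above2 , y-above2 , disjoint = orthogonal⇒disjoint G pair
        -- `S` is the exact support of `x`; that `x` vanishes nowhere on `S` will force `y` to
        -- vanish on `M`.
        S , ∈S⇒x≉0 , x≉0⇒∈S   = comprehension em (λ i → ¬ (x i ≈ 0#))
        x-supported : Supported S x
        x-supported i i∉S = [ id , (λ x≉0 → contradiction (x≉0⇒∈S x≉0) i∉S) ]′ (≈0-or-≉0 (x i))
        M , M⊆S , minimal = minimal-subgraph G S (x , x-supported , x-above2)
        y-supported : Supported (∁ M) y
        y-supported i i∉∁M =
          [ (λ x≈0 → contradiction x≈0 (∈S⇒x≉0 (M⊆S (x∉∁p⇒x∈p i∉∁M)))) , id ]′ (disjoint i)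
    in above2-noncyclotomic (G [ ∁ M ]) (above2-restrict G (∁ M) y-supported y-above2)
         (complements M minimal)
    where
    ≈0-or-≉0 : ∀ a → a ≈ 0# ⊎ ¬ (a ≈ 0#)
    ≈0-or-≉0 a with em {a ≈ 0#}
    ... | yes a≈0 = inj₁ a≈0
    ... | no  a≉0 = inj₂ a≉0

theorem8 : ExcludedMiddle 0ℓ → (ℝ : CompleteOrderedField) →
    let open Spectrum ℝ in
    (∀ (n : ℕ) (G : Graph n) → ¬ Cyclotomic G → Bipartite G →
    (∃[ v ] Cyclotomic (deleteVertex G v)) →
    Salem G)
    ×
    (∀ (n : ℕ) (G : Graph n) → ¬ Cyclotomic G → Bipartite G →
    (∀ (S : Subset n) → Minimal (G [ S ]) → Cyclotomic (G [ ∁ S ])) →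
    Salem G)
theorem8 em ℝ =
  (λ n G noncyclotomic bipartite (v , cyclotomic) →
    salem-criterion G noncyclotomic bipartite (deletion-no-pair G v cyclotomic)) ,
  (λ n G noncyclotomic bipartite complements →
    salem-criterion G noncyclotomic bipartite (minimal-complements-no-pair G complements))
  where open SalemGraphs em ℝ
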